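{- Let $n$ be a positive integer, let $G$ be a connected graph with at least $n$ vertices and minimum degree $\delta(G)\geq n-3$, and let $T_n$ be a tree with $n$ vertices and maximum degree $\Delta(T_n)\leq n-3$. Then $T_n$ can be embedded into $G$ if and only if neither of the following situations happens: (i) $G$ is isomorphic to $K_{n-3,n-3}$ and $T_n$ is isomorphic to $T(p,n-3-p)$ for some integer $p\geq 1$; (ii) $G$ is isomorphic to a balanced complete $(k+1)$-partite graph with $a$ vertices in each part, where $k\geq 2$ and $a$ are positive integers with $ka=n-3$, and $T_n$ is isomorphic to $T(1,n-4)$.
   Context: All graphs are simple. A graph $F$ can be embedded into a graph $G$ if there is an injection $\phi:V(F)\to V(G)$ such that $\phi(x)\phi(y)\in E(G)$ for every edge $xy\in E(F)$ (i.e. $G$ contains a copy of $F$ as a subgraph). For positive integers $p,q$, $T(p,q)$ denotes the tree having a longest path $v_1v_2v_3v_4v_5$ with $d(v_3)=2$, where $v_2$ is adjacent to exactly $p$ leaves and $v_4$ is adjacent to exactly $q$ leaves; equivalently, $T(p,q)$ consists of a vertex $v_3$ adjacent to exactly two vertices $v_2,v_4$, where $v_2$ has $p$ further neighbours that are leaves and $v_4$ has $q$ further neighbours that are leaves (so $T(p,q)$ has $p+q+3$ vertices). -}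

module Defs where

open import Data.Nat using (ℕ; zero; suc; _+_; _*_; _≤_; _<_; _≡ᵇ_; _≤ᵇ_; _<ᵇ_)
open import Data.Bool using (Bool; true; false; _∧_; _∨_; not; if_then_else_)
open import Data.Bool.Properties using (∨-comm)
open import Data.Fin using (Fin; toℕ; fromℕ; inject₁; quotient; _≟_)
import Data.Fin as F
open import Data.List using (List; map; allFin)
open import Data.Nat.ListAction using (sum)
open import Data.Product using (Σ; _×_; _,_)
open import Function.Definitions using (Injective)
open import Function.Bundles using (_↔_; Inverse)
open import Relation.Binary.PropositionalEquality using (_≡_; refl; cong₂)
open import Relation.Nullary.Decidable using (⌊_⌋; yes; no)

record Graph (m : ℕ) : Set where
  field
    adj    : Fin m → Fin m → Bool
    sym    : ∀ x y → adj x y ≡ adj y x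
    irrefl : ∀ x → adj x x ≡ false
open Graph public

Edge : ∀ {m} → Graph m → Fin m → Fin m → Set
Edge G x y = adj G x y ≡ true

private
  ≟-sym : ∀ {m} (x y : Fin m) → ⌊ x ≟ y ⌋ ≡ ⌊ y ≟ x ⌋
  ≟-sym x y with x ≟ y | y ≟ x
  ... | yes _ | yes _ = refl
  ... | no _  | no _  = refl
  ... | yes refl | no ¬p = Data.Empty.⊥-elim (¬p refl)
    where import Data.Empty
  ... | no ¬p | yes refl = Data.Empty.⊥-elim (¬p refl)
    where import Data.Empty

  ≟-refl : ∀ {m} (x : Fin m) → ⌊ x ≟ x ⌋ ≡ true
  ≟-refl x with x ≟ x
  ... | yes _ = refl
  ... | no ¬p = Data.Empty.⊥-elim (¬p refl)
    where import Data.Empty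

simple : ∀ {m} → (Fin m → Fin m → Bool) → Graph m
simple f = record
  { adj    = λ x y → not ⌊ x ≟ y ⌋ ∧ (f x y ∨ f y x)
  ; sym    = λ x y → cong₂ (λ a b → not a ∧ b) (≟-sym x y) (∨-comm (f x y) (f y x))
  ; irrefl = λ x → Relation.Binary.PropositionalEquality.cong (λ a → not a ∧ (f x x ∨ f x x)) (≟-refl x)
  }

deg : ∀ {m} → Graph m → Fin m → ℕ
deg {m} G x = sum (map (λ y → if adj G x y then 1 else 0) (allFin m))

data Reach {m} (G : Graph m) : Fin m → Fin m → Set where
  here : ∀ {x} → Reach G x x
  step : ∀ {x y z} → Edge G x y → Reach G y z → Reach G x z

Connected : ∀ {m} → Graph m → Set
Connected {m} G = (x y : Fin m) → Reach G x y

HasCycle : ∀ {m} → Graph m → Set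
HasCycle {m} G =
  Σ ℕ λ k → Σ (Fin (3 + k) → Fin m) λ c →
    Injective _≡_ _≡_ c
    × ((i : Fin (2 + k)) → Edge G (c (inject₁ i)) (c (F.suc i)))
    × Edge G (c (fromℕ (2 + k))) (c F.zero)

IsTree : ∀ {m} → Graph m → Set
IsTree G = Connected G × (HasCycle G → Data.Empty.⊥)
  where import Data.Empty

Embeds : ∀ {a b} → Graph a → Graph b → Set
Embeds {a} {b} F G =
  Σ (Fin a → Fin b) λ φ → Injective _≡_ _≡_ φ × (∀ x y → Edge F x y → Edge G (φ x) (φ y))

infix 4 _≅_
_≅_ : ∀ {a b} → Graph a → Graph b → Set
_≅_ {a} {b} G H =
  Σ (Fin a ↔ Fin b) λ φ → ∀ x y → adj G x y ≡ adj H (Inverse.to φ x) (Inverse.to φ y)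

CompleteMultipartite : (r s : ℕ) → Graph (r * s)
CompleteMultipartite r s = simple (λ i j → not ⌊ quotient {r} s i ≟ quotient {r} s j ⌋)

CompleteBipartite : (s : ℕ) → Graph (2 * s)
CompleteBipartite s = CompleteMultipartite 2 s

-- The tree T(p,q) on p+q+3 vertices: vertex 0 is v3, vertex 1 is v2,
-- vertex 2 is v4; vertices 3 .. p+2 are the leaves at v2, and
-- vertices p+3 .. p+q+2 are the leaves at v4.
private
  tpq : ℕ → ℕ → ℕ → Bool
  tpq p i j =
       ((i ≡ᵇ 0) ∧ ((j ≡ᵇ 1) ∨ (j ≡ᵇ 2)))
    ∨ ((i ≡ᵇ 1) ∧ ((3 ≤ᵇ j) ∧ (j <ᵇ p + 3)))
    ∨ ((i ≡ᵇ 2) ∧ (p + 3 ≤ᵇ j))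

T : (p q : ℕ) → Graph (p + q + 3)
T p q = simple (λ i j → tpq p (toℕ i) (toℕ j))

-- Write n = d + 3, suppose that the tree F does not embed in G, and delete two leaves x, y of F, with x hanging on u.
-- What is left has d + 1 vertices, so any embedding of a connected part of it that contains u extends greedily to
-- all of it. Choosing x, y near the ends of a longest path of F (two leaves at one end u, or one at each end when both
-- have degree 2), F embeds as soon as two neighbours of the image v of u stay unused. Their number is at least
-- deg v - d plus the number of vertices of the image outside N[v]. Hence G is d-regular, and no embedded part of F can
-- contain two vertices outside N[v]. Unless F is a path on five vertices, trying out small parts of F shows that
-- non-adjacent vertices of G have the same neighbours, so G is balanced complete multipartite, and that F is some
-- T(p,q) or a path on six vertices. The two paths embed directly, and what remains are the two exceptions.

module Submission where

open import Defs renaming (sym to adj-sym; irrefl to adj-irrefl)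
open import Data.Bool as Bool using (Bool; true; false; _∧_; _∨_; not; if_then_else_)
open import Data.Empty using (⊥; ⊥-elim)
open import Data.Fin using (Fin; zero; suc; toℕ; inject₁; fromℕ; fromℕ<; cast; quotient; remainder; combine; punchOut; _≟_)
open import Data.Fin.Properties using (any?; all?; remQuot-combine; combine-remQuot; combine-injective; cast-is-id; toℕ-cast; injective⇒≤; punchOut-injective)
open import Data.List using (List; []; _∷_; length; map; filter; allFin; _++_; lookup; reverse)
open import Data.List.Properties using (length-++; length-map; length-tabulate; length-reverse; unfold-reverse; filter-reject; length-filter)
open import Data.List.Membership.Propositional using (_∈_; _∉_)
open import Data.List.Membership.Propositional.Properties
open import Data.List.Relation.Unary.All as All using (All; []; _∷_)
open import Data.List.Relation.Unary.All.Properties using (¬Any⇒All¬; All¬⇒¬Any)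
open import Data.List.Relation.Unary.AllPairs using ([]; _∷_)
open import Data.List.Relation.Unary.Any using (here; there; index)
open import Data.List.Relation.Unary.Any.Properties using (lookup-index; reverse⁻)
open import Data.List.Relation.Unary.Unique.Propositional using (Unique)
import Data.List.Relation.Unary.Unique.Propositional.Properties as Uniq
open import Data.Nat using (ℕ; zero; suc; _+_; _*_; _≤_; _<_; _∸_; z≤n; s≤s; _≤?_; _<ᵇ_; _≤ᵇ_; _≡ᵇ_)
open import Data.Nat.ListAction using (sum)
open import Data.Nat.Properties hiding (_≟_)
open import Data.Product using (Σ; ∃; ∃₂; _×_; _,_; proj₁; proj₂; swap)
open import Data.Sum using (_⊎_; inj₁; inj₂; [_,_]′)
open import Data.Vec.Functional as Vector using ()
open import Function using (_∘_; id; case_of_)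
open import Function.Bundles using (_⇔_; mk⇔; mk↔ₛ′; Inverse)
open import Function.Definitions using (Injective)
open import Relation.Binary.PropositionalEquality using (_≡_; _≢_; refl; sym; trans; cong; cong₂; subst; subst₂)
open import Relation.Nullary using (¬_; Dec; yes; no; ¬?)
open import Relation.Nullary.Decidable using (_×-dec_; _→-dec_; map′; decidable-stable; ⌊_⌋; isYes)
open import Relation.Unary using (Decidable)

-- Finite graphs

-- Deleting two leaves rather than one makes the greedy step free: while at most `d` vertices are
-- placed, a closed neighbourhood, having at least `d + 1` vertices, contains a free one. The price
-- is paid at the end, where `d` neighbours of `v` may be occupied; each image vertex outside the
-- closed neighbourhood releases one, so two of them pay for both leaves. As `G` has at least
-- `d + 3` vertices, once it is regular every vertex has two non-neighbours besides itself, and the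
-- question is which small trees reach two of them. If the deleted leaves hang at different ends,
-- two free neighbours at one end do not obviously help the other leaf. A failure there forces the
-- image to be a clique joined to the rest of `G` through the image of `u` alone, and inside a
-- clique the tree can be rearranged. So both kinds of ends share one notion, `Completable`. The
-- path on five vertices stands apart because only three of its vertices remain, and along an
-- induced path these reach just one non-neighbour.

length-allFin : ∀ m → length (allFin m) ≡ m
length-allFin m = length-tabulate id

-- The target `⊥` makes excluded middle available for propositions that are not decided, such as the
-- existence of a longer path.
em : ∀ {P : Set} → (P ⊎ ¬ P → ⊥) → ⊥
em k = k (inj₂ (k ∘ inj₁))

lookup-injective : ∀ {A : Set} {l : List A} → Unique l → ∀ i j → lookup l i ≡ lookup l j → i ≡ j
lookup-injective {l = _ ∷ _} _ zero zero _ = refl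
lookup-injective {l = _ ∷ l} (a ∷ _) zero (suc j) e = ⊥-elim (All.lookup a (∈-lookup {xs = l} j) e)
lookup-injective {l = _ ∷ l} (a ∷ _) (suc i) zero e = ⊥-elim (All.lookup a (∈-lookup {xs = l} i) (sym e))
lookup-injective {l = _ ∷ _} (_ ∷ u) (suc i) (suc j) e = cong suc (lookup-injective u i j e)

module _ {m : ℕ} where

  open import Data.List.Membership.DecPropositional (_≟_ {m}) public using (_∈?_)

  cons-unique : {x : Fin m} {xs : List (Fin m)} → x ∉ xs → Unique xs → Unique (x ∷ xs)
  cons-unique x∉ u = ¬Any⇒All¬ _ x∉ ∷ u

  uncons-unique : {x : Fin m} {xs : List (Fin m)} → Unique (x ∷ xs) → x ∉ xs × Unique xs
  uncons-unique (a ∷ u) = All¬⇒¬Any a , u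

  remove : (y : Fin m) {ys : List (Fin m)} → y ∈ ys →
           ∃ λ zs → length ys ≡ suc (length zs) × (∀ {x} → x ∈ ys → x ≢ y → x ∈ zs)
  remove y {_ ∷ zs} (here refl) = zs , refl , λ { (here refl) x≢y → ⊥-elim (x≢y refl) ; (there x∈) _ → x∈ }
  remove y {w ∷ ys} (there y∈) with remove y y∈
  ... | zs , e , f = w ∷ zs , cong suc e , λ { (here refl) _ → here refl ; (there x∈) ne → there (f x∈ ne) }

  unique-⊆-length : {xs ys : List (Fin m)} → Unique xs → (∀ {x} → x ∈ xs → x ∈ ys) → length xs ≤ length ys
  unique-⊆-length {[]} _ _ = z≤n
  unique-⊆-length {x ∷ xs} u sub with uncons-unique u | remove x (sub (here refl))
  ... | x∉ , u' | zs , e , f = subst (suc (length xs) ≤_) (sym e)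
    (s≤s (unique-⊆-length u' λ z∈ → f (sub (there z∈)) λ { refl → x∉ z∈ }))

  fresh : {xs : List (Fin m)} (ys : List (Fin m)) → Unique xs → length ys < length xs → ∃ λ x → x ∈ xs × x ∉ ys
  fresh {xs} ys u lt with any? (λ x → (x ∈? xs) ×-dec ¬? (x ∈? ys))
  ... | yes r = r
  ... | no ¬r = ⊥-elim (<⇒≱ lt (unique-⊆-length u λ {x} x∈ → decidable-stable (x ∈? ys) λ x∉ → ¬r (x , x∈ , x∉)))

  unique-⊆-full : {xs ys : List (Fin m)} → Unique xs → (∀ {x} → x ∈ xs → x ∈ ys) → length ys ≤ length xs →
                  ∀ {y} → y ∈ ys → y ∈ xs
  unique-⊆-full {xs} u sub le {y} y∈ = decidable-stable (y ∈? xs) λ y∉ →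
    <⇒≱ (unique-⊆-length (cons-unique y∉ u) λ { (here refl) → y∈ ; (there z∈) → sub z∈ }) le

  unique-length≤ : {xs : List (Fin m)} → Unique xs → length xs ≤ m
  unique-length≤ {xs} u = subst (length xs ≤_) (length-allFin m) (unique-⊆-length u λ {x} _ → ∈-allFin x)

module _ {m : ℕ} (G : Graph m) where

  edge? : ∀ x y → Dec (Edge G x y)
  edge? x y = adj G x y Bool.≟ true

  edge-sym : ∀ {x y} → Edge G x y → Edge G y x
  edge-sym {x} {y} e = trans (adj-sym G y x) e

  edge-irrefl : ∀ {x} → ¬ Edge G x x
  edge-irrefl {x} e with trans (sym e) (adj-irrefl G x)
  ... | ()

  edge-≢ : ∀ {x y} → Edge G x y → x ≢ y
  edge-≢ e refl = edge-irrefl e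

  nbrs : Fin m → List (Fin m)
  nbrs x = filter (edge? x) (allFin m)

  ∈nbrs⁺ : ∀ {x y} → Edge G x y → y ∈ nbrs x
  ∈nbrs⁺ {x} e = ∈-filter⁺ (edge? x) (∈-allFin _) e

  ∈nbrs⁻ : ∀ {x y} → y ∈ nbrs x → Edge G x y
  ∈nbrs⁻ {x} y∈ = proj₂ (∈-filter⁻ (edge? x) {xs = allFin m} y∈)

  nbrs-unique : ∀ x → Unique (nbrs x)
  nbrs-unique x = Uniq.filter⁺ (edge? x) (Uniq.allFin⁺ m)

  ∉nbrs-self : ∀ {x} → x ∉ nbrs x
  ∉nbrs-self = edge-irrefl ∘ ∈nbrs⁻

  length-nbrs : ∀ x → length (nbrs x) ≡ deg G x
  length-nbrs x = go (allFin m)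
    where
    go : ∀ zs → length (filter (edge? x) zs) ≡ sum (map (λ y → if adj G x y then 1 else 0) zs)
    go [] = refl
    go (z ∷ zs) with adj G x z
    ... | true = cong suc (go zs)
    ... | false = go zs

  two-nbrs : ∀ {v} → 2 ≤ deg G v → ∃₂ λ a a′ → a ≢ a′ × Edge G v a × Edge G v a′
  two-nbrs {v} two with fresh [] (nbrs-unique v) (subst (1 ≤_) (sym (length-nbrs v)) (≤-trans (n≤1+n 1) two))
  ... | a , a∈ , _ with fresh (a ∷ []) (nbrs-unique v) (subst (2 ≤_) (sym (length-nbrs v)) two)
  ... | a′ , a′∈ , a′∉ = a , a′ , (λ e → a′∉ (here (sym e))) , ∈nbrs⁻ a∈ , ∈nbrs⁻ a′∈

  closed : {P : Fin m → Set} → (∀ {s t} → P s → Edge G s t → P t) → ∀ {x y} → Reach G x y → P x → P y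
  closed f here px = px
  closed f (step e r) px = closed f r (f px e)

  closed-covers : Connected G → ∀ {v} (W : List (Fin m)) → v ∈ W → (∀ {s t} → s ∈ W → Edge G s t → t ∈ W) → ∀ x → x ∈ W
  closed-covers con W v∈ f x = closed f (con _ x) v∈

  closed-length : Connected G → ∀ {v} (W : List (Fin m)) → v ∈ W → (∀ {s t} → s ∈ W → Edge G s t → t ∈ W) → m ≤ length W
  closed-length con W v∈ f = subst (_≤ length W) (length-allFin m)
    (unique-⊆-length (Uniq.allFin⁺ m) λ {x} _ → closed-covers con W v∈ f x)

  -- If no vertex were at distance two from `v`, its closed neighbourhood would be closed under
  -- adjacency, hence all of the connected `G`, against the size bound.
  induced-path : Connected G → ∀ v → suc (deg G v) < m →
                 ∃₂ λ a b → Edge G v a × Edge G a b × b ≢ v × ¬ Edge G v b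
  induced-path con v lt with any? (λ a → any? λ b → edge? v a ×-dec (edge? a b ×-dec (¬? (b ≟ v) ×-dec ¬? (edge? v b))))
  ... | yes r = r
  ... | no ¬r = ⊥-elim (<⇒≱ lt (subst (λ k → m ≤ suc k) (length-nbrs v) (closed-length con (v ∷ nbrs v) (here refl) cl)))
    where
    cl : ∀ {s t} → s ∈ v ∷ nbrs v → Edge G s t → t ∈ v ∷ nbrs v
    cl (here refl) e = there (∈nbrs⁺ e)
    cl {s} {t} (there s∈) e with t ≟ v | edge? v t
    ... | yes refl | _ = here refl
    ... | no _ | yes f = there (∈nbrs⁺ f)
    ... | no ne | no nf = ⊥-elim (¬r (s , t , ∈nbrs⁻ s∈ , e , ne , nf))

  data Path : Fin m → Fin m → List (Fin m) → Set where
    nil  : ∀ {x} → Path x x (x ∷ [])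
    cons : ∀ {x y z l} → Edge G x y → Path y z l → Path x z (x ∷ l)

  snoc : ∀ {x y z l} → Path x y l → Edge G y z → Path x z (l ++ z ∷ [])
  snoc nil e = cons e nil
  snoc (cons e' p) e = cons e' (snoc p e)

  reverse-path : ∀ {x y l} → Path x y l → Path y x (reverse l)
  reverse-path nil = nil
  reverse-path {x} {y} (cons {l = l} e p) = subst (Path y x) (sym (unfold-reverse x l)) (snoc (reverse-path p) (edge-sym e))

  path-cycle : ∀ {x z a b c l} → Path x z (a ∷ b ∷ c ∷ l) → Unique (a ∷ b ∷ c ∷ l) → Edge G x z → HasCycle G
  path-cycle {a = a} {b} {c} {l} p u e = length l , lookup (a ∷ b ∷ c ∷ l) , (λ {i} {j} → lookup-injective u i j) , (λ i → edges p i) , last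
    where
    edges : ∀ {x z a l} → Path x z (a ∷ l) → ∀ (i : Fin (length l)) → Edge G (lookup (a ∷ l) (inject₁ i)) (lookup l i)
    edges (cons e nil) zero = e
    edges (cons e (cons _ _)) zero = e
    edges (cons e p@(cons _ _)) (suc i) = edges p i
    head-eq : ∀ {x z a l} → Path x z (a ∷ l) → a ≡ x
    head-eq nil = refl
    head-eq (cons _ _) = refl
    last-eq : ∀ {x z a} {l : List (Fin m)} → Path x z (a ∷ l) → lookup (a ∷ l) (fromℕ (length l)) ≡ z
    last-eq nil = refl
    last-eq (cons _ p@nil) = last-eq p
    last-eq (cons _ p@(cons _ _)) = last-eq p
    last = subst (λ v → Edge G v _) (sym (last-eq {l = b ∷ c ∷ l} p)) (subst (Edge G _) (sym (head-eq p)) (edge-sym e))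

-- Partial embeddings of a tree

module _ {n m : ℕ} (F : Graph n) (G : Graph m) where

  dom : List (Fin n × Fin m) → List (Fin n)
  dom = map proj₁

  ran : List (Fin n × Fin m) → List (Fin m)
  ran = map proj₂

  -- Each new vertex is attached to one already placed. In an acyclic F that neighbour is unique (unique-parent),
  -- so checking the one edge suffices for a homomorphism.
  data Partial : List (Fin n × Fin m) → Set where
    start : ∀ u v → Partial ((u , v) ∷ [])
    grow  : ∀ {L x a y b} → x ∉ dom L → a ∉ ran L → (y , b) ∈ L → Edge F y x → Edge G b a →
            Partial L → Partial ((x , a) ∷ L)

  dom-unique : ∀ {L} → Partial L → Unique (dom L)
  dom-unique (start _ _) = [] ∷ []
  dom-unique (grow x∉ _ _ _ _ p) = cons-unique x∉ (dom-unique p)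

  ran-unique : ∀ {L} → Partial L → Unique (ran L)
  ran-unique (start _ _) = [] ∷ []
  ran-unique (grow _ a∉ _ _ _ p) = cons-unique a∉ (ran-unique p)

  -- Each new vertex is joined in `F` to an old one, so the domain is connected. The path has to
  -- stay in the domain: a vertex outside with neighbours at both of its ends then closes it to a
  -- cycle.
  dom-path : ∀ {L} → Partial L → ∀ {y z} → y ∈ dom L → z ∈ dom L →
             ∃ λ l → Path F y z l × Unique l × (∀ {t} → t ∈ l → t ∈ dom L)
  dom-path (start u v) (here refl) (here refl) = u ∷ [] , nil , [] ∷ [] , id
  dom-path (grow {x = x} _ _ _ _ _ _) (here refl) (here refl) = x ∷ [] , nil , [] ∷ [] , λ { (here e) → here e }
  dom-path (grow {x = x} x∉ _ w∈ e _ p) (here refl) (there z∈) with dom-path p (∈-map⁺ proj₁ w∈) z∈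
  ... | l , q , u , sub = x ∷ l , cons (edge-sym F e) q , cons-unique (x∉ ∘ sub) u ,
        λ { (here e) → here e ; (there t∈) → there (sub t∈) }
  dom-path (grow {x = x} x∉ _ w∈ e _ p) (there y∈) (here refl) with dom-path p y∈ (∈-map⁺ proj₁ w∈)
  ... | l , q , u , sub = l ++ x ∷ [] , snoc F q e ,
        Uniq.++⁺ u ([] ∷ []) (λ { (t∈ , here refl) → x∉ (sub t∈) }) ,
        λ t∈ → case ∈-++⁻ l t∈ of λ { (inj₁ t∈l) → there (sub t∈l) ; (inj₂ (here e)) → here e }
  dom-path (grow _ _ _ _ _ p) (there y∈) (there z∈) with dom-path p y∈ z∈
  ... | l , q , u , sub = l , q , u , there ∘ sub

  functional : ∀ {L} → Partial L → ∀ {z b c} → (z , b) ∈ L → (z , c) ∈ L → b ≡ c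
  functional p@(start _ _) (here refl) (here refl) = refl
  functional (grow _ _ _ _ _ _) (here refl) (here refl) = refl
  functional (grow x∉ _ _ _ _ _) (here refl) (there c∈) = ⊥-elim (x∉ (∈-map⁺ proj₁ c∈))
  functional (grow x∉ _ _ _ _ _) (there b∈) (here refl) = ⊥-elim (x∉ (∈-map⁺ proj₁ b∈))
  functional (grow _ _ _ _ _ p) (there b∈) (there c∈) = functional p b∈ c∈

  injective : ∀ {L} → Partial L → ∀ {y z b} → (y , b) ∈ L → (z , b) ∈ L → y ≡ z
  injective p@(start _ _) (here refl) (here refl) = refl
  injective (grow _ _ _ _ _ _) (here refl) (here refl) = refl
  injective (grow _ a∉ _ _ _ _) (here refl) (there c∈) = ⊥-elim (a∉ (∈-map⁺ proj₂ c∈))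
  injective (grow _ a∉ _ _ _ _) (there b∈) (here refl) = ⊥-elim (a∉ (∈-map⁺ proj₂ b∈))
  injective (grow _ _ _ _ _ p) (there b∈) (there c∈) = injective p b∈ c∈

  toFun : ∀ {L} → Partial L → Fin n → Fin m
  toFun {L} p x with x ∈? dom L
  ... | yes x∈ = proj₂ (proj₁ (∈-map⁻ proj₁ x∈))
  toFun {[]} () x | no _
  -- An arbitrary default; the function is only used on the domain of `L`.
  toFun {(u , v) ∷ _} p x | no _ = v

  toFun-∈ : ∀ {L} (p : Partial L) {x} → x ∈ dom L → (x , toFun p x) ∈ L
  toFun-∈ {L} p {x} x∈ with x ∈? dom L
  ... | no x∉ = ⊥-elim (x∉ x∈)
  ... | yes x∈′ with ∈-map⁻ proj₁ x∈′
  ... | (_ , a) , ∈L , refl = ∈L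

  toFun-≡ : ∀ {L} (p : Partial L) {x a} → (x , a) ∈ L → toFun p x ≡ a
  toFun-≡ p x∈ = functional p (toFun-∈ p (∈-map⁺ proj₁ x∈)) x∈

  module _ (acyclic : ¬ HasCycle F) where

    unique-parent : ∀ {L} → Partial L → ∀ {x y z} → x ∉ dom L → y ∈ dom L → z ∈ dom L →
                    Edge F x y → Edge F x z → y ≡ z
    unique-parent p x∉ y∈ z∈ xy xz with dom-path p y∈ z∈
    ... | _ , nil , _ , _ = refl
    ... | _ , q@(cons _ nil) , u , sub = ⊥-elim (acyclic (path-cycle F (cons xy q) (cons-unique (x∉ ∘ sub) u) xz))
    ... | _ , q@(cons _ (cons _ _)) , u , sub = ⊥-elim (acyclic (path-cycle F (cons xy q) (cons-unique (x∉ ∘ sub) u) xz))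

    homomorphic : ∀ {L} → Partial L → ∀ {y z b c} → (y , b) ∈ L → (z , c) ∈ L → Edge F y z → Edge G b c
    homomorphic (start _ _) (here refl) (here refl) e = ⊥-elim (edge-irrefl F e)
    homomorphic (grow _ _ _ _ _ _) (here refl) (here refl) e = ⊥-elim (edge-irrefl F e)
    homomorphic (grow x∉ _ w∈ f g p) (here refl) (there z∈) e
      with refl ← unique-parent p x∉ (∈-map⁺ proj₁ z∈) (∈-map⁺ proj₁ w∈) e (edge-sym F f)
      with refl ← functional p z∈ w∈ = edge-sym G g
    homomorphic (grow x∉ _ w∈ f g p) (there y∈) (here refl) e
      with refl ← unique-parent p x∉ (∈-map⁺ proj₁ y∈) (∈-map⁺ proj₁ w∈) (edge-sym F e) (edge-sym F f)
      with refl ← functional p y∈ w∈ = g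
    homomorphic (grow _ _ _ _ _ p) (there y∈) (there z∈) e = homomorphic p y∈ z∈ e

Leaf : ∀ {n} → Graph n → Fin n → Fin n → Set
Leaf F x p = Edge F x p × (∀ z → Edge F x z → z ≡ p)

-- Deleting the leaves x and y keeps F connected, so a partial embedding avoiding them can always be continued.
module _ {d m : ℕ} (F : Graph (3 + d)) (G : Graph m)
         (connected : Connected F) (δ : ∀ v → d ≤ deg G v)
         {x y p q : Fin (3 + d)} (leaf-x : Leaf F x p) (leaf-y : Leaf F y q) where

  exit : ∀ {z₀} (S : List (Fin (3 + d))) → z₀ ∈ S → x ∉ S → y ∉ S → length S ≤ d →
         ∃₂ λ s t → s ∈ S × t ∉ x ∷ y ∷ S × Edge F s t
  exit {z₀} S z₀∈ x∉ y∉ le with any? (λ s → any? λ t → (s ∈? S) ×-dec (¬? (t ∈? (x ∷ y ∷ S)) ×-dec edge? F s t))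
  ... | yes r = r
  ... | no ¬r with fresh (x ∷ y ∷ S) (Uniq.allFin⁺ (3 + d)) (subst (2 + length S <_) (sym (length-allFin (3 + d))) (s≤s (s≤s (s≤s le))))
  ... | z , _ , z∉ = ⊥-elim (bad (closed F {Good} cl (connected z₀ z) (inj₁ z₀∈)))
    where
    Good : Fin (3 + d) → Set
    Good t = t ∈ S ⊎ ((t ≡ x × p ∈ S) ⊎ (t ≡ y × q ∈ S))
    cl : ∀ {s t} → Good s → Edge F s t → Good t
    cl {s} {t} (inj₁ s∈) e with t ∈? (x ∷ y ∷ S)
    ... | yes (here refl) = inj₂ (inj₁ (refl , subst (_∈ S) (proj₂ leaf-x _ (edge-sym F e)) s∈))
    ... | yes (there (here refl)) = inj₂ (inj₂ (refl , subst (_∈ S) (proj₂ leaf-y _ (edge-sym F e)) s∈))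
    ... | yes (there (there t∈)) = inj₁ t∈
    ... | no t∉ = ⊥-elim (¬r (s , t , s∈ , t∉ , e))
    cl (inj₂ (inj₁ (refl , p∈))) e = inj₁ (subst (_∈ S) (sym (proj₂ leaf-x _ e)) p∈)
    cl (inj₂ (inj₂ (refl , q∈))) e = inj₁ (subst (_∈ S) (sym (proj₂ leaf-y _ e)) q∈)
    bad : ¬ Good z
    bad (inj₁ z∈) = z∉ (there (there z∈))
    bad (inj₂ (inj₁ (e , _))) = z∉ (here e)
    bad (inj₂ (inj₂ (e , _))) = z∉ (there (here e))

  extend : ∀ k {L z₀} → Partial F G L → z₀ ∈ L → x ∉ dom F G L → y ∉ dom F G L → length L + k ≡ suc d →
           ∃ λ L′ → Partial F G L′ × (∀ {t} → t ∈ L → t ∈ L′) × length L′ ≡ suc d × x ∉ dom F G L′ × y ∉ dom F G L′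
  extend zero {L} P _ x∉ y∉ e = L , P , id , trans (sym (+-identityʳ _)) e , x∉ , y∉
  extend (suc k) {L} P z₀∈ x∉ y∉ e
    with exit (dom F G L) (∈-map⁺ proj₁ z₀∈) x∉ y∉ (subst (_≤ d) (sym (length-map proj₁ L)) le)
    where
    le : length L ≤ d
    le = ≤-pred (subst (suc (length L) ≤_) e (subst (suc (length L) ≤_) (sym (+-suc (length L) k)) (s≤s (m≤m+n _ k))))
  ... | s , t , s∈ , t∉ , st with ∈-map⁻ proj₁ s∈
  ... | (_ , b) , sb∈ , refl
    -- `b` itself is occupied, so its closed neighbourhood, with at least `d + 1` members, is
    -- compared with the at most `d` occupied vertices.
    with fresh (ran F G L) (cons-unique (∉nbrs-self G {b}) (nbrs-unique G b))
           (s≤s (subst₂ _≤_ (sym (length-map proj₂ L)) (sym (length-nbrs G b)) (≤-trans le (δ b))))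
    where
    le : length L ≤ d
    le = ≤-pred (subst (suc (length L) ≤_) e (subst (suc (length L) ≤_) (sym (+-suc (length L) k)) (s≤s (m≤m+n _ k))))
  ... | a , here refl , a∉ = ⊥-elim (a∉ (∈-map⁺ proj₂ sb∈))
  ... | a , there a∈ , a∉
    with extend k (grow (λ t∈ → t∉ (there (there t∈))) a∉ sb∈ st (∈nbrs⁻ G a∈) P) (there z₀∈)
           (λ { (here refl) → t∉ (here refl) ; (there x∈) → x∉ x∈ })
           (λ { (here refl) → t∉ (there (here refl)) ; (there y∈) → y∉ y∈ })
           (trans (sym (+-suc (length L) k)) e)
  ... | L′ , P′ , sub , len , x∉′ , y∉′ = L′ , P′ , sub ∘ there , len , x∉′ , y∉′

-- Attaching the two deleted leaves again

module _ {n m : ℕ} (F : Graph n) (G : Graph m) (x y : Fin n) where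

  Kept : Fin n → Set
  Kept t = t ≢ x × t ≢ y

  -- An embedding of `F` without `x` and `y`, kept as a total function whose values at `x` and `y`
  -- are arbitrary.
  record Off (φ : Fin n → Fin m) : Set where
    field
      off-inj : ∀ {s t} → Kept s → Kept t → φ s ≡ φ t → s ≡ t
      off-hom : ∀ {s t} → Kept s → Kept t → Edge F s t → Edge G (φ s) (φ t)

  Unused : (Fin n → Fin m) → Fin m → Set
  Unused φ o = ∀ {t} → Kept t → φ t ≢ o

  -- Stated contrapositively: two unused neighbours of φ u suffice to embed F.
  Completable : Fin n → Set
  Completable u = ∀ {φ} → Off φ → ∀ {o₁ o₂} → o₁ ≢ o₂ → Unused φ o₁ → Unused φ o₂ →
                  Edge G (φ u) o₁ → Edge G (φ u) o₂ → ⊥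

module _ {n m : ℕ} {F : Graph n} {G : Graph m} {x y : Fin n} where
  open Off

  module _ {p q : Fin n} (x≢y : x ≢ y) (leaf-x : Leaf F x p) (leaf-y : Leaf F y q)
           (Kp : Kept F G x y p) (Kq : Kept F G x y q) where

    add-leaves : ∀ {φ} → Off F G x y φ → ∀ {x′ y′} → x′ ≢ y′ → Unused F G x y φ x′ → Unused F G x y φ y′ →
                 Edge G (φ p) x′ → Edge G (φ q) y′ → Embeds F G
    add-leaves {φ} off {x′} {y′} x′≢y′ ux uy ex ey = ψ , inj , hom
      where
      ψ : Fin n → Fin m
      ψ t with t ≟ x | t ≟ y
      ... | yes _ | _ = x′
      ... | no _ | yes _ = y′
      ... | no _ | no _ = φ t
      inj : Injective _≡_ _≡_ ψ
      inj {s} {t} e with s ≟ x | s ≟ y | t ≟ x | t ≟ y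
      ... | yes refl | _ | yes refl | _ = refl
      ... | yes refl | _ | no _ | yes refl = ⊥-elim (x′≢y′ e)
      ... | yes refl | _ | no a | no b = ⊥-elim (ux (a , b) (sym e))
      ... | no _ | yes refl | yes refl | _ = ⊥-elim (x′≢y′ (sym e))
      ... | no _ | yes refl | no _ | yes refl = refl
      ... | no _ | yes refl | no a | no b = ⊥-elim (uy (a , b) (sym e))
      ... | no a | no b | yes refl | _ = ⊥-elim (ux (a , b) e)
      ... | no a | no b | no _ | yes refl = ⊥-elim (uy (a , b) e)
      ... | no a | no b | no a′ | no b′ = off-inj off (a , b) (a′ , b′) e
      hom : ∀ s t → Edge F s t → Edge G (ψ s) (ψ t)
      hom s t e with s ≟ x | s ≟ y | t ≟ x | t ≟ y
      ... | yes refl | _ | yes refl | _ = ⊥-elim (edge-irrefl F e)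
      ... | yes refl | _ | no _ | yes refl = ⊥-elim (proj₂ Kp (sym (proj₂ leaf-x t e)))
      ... | yes refl | _ | no _ | no _ = subst (λ z → Edge G x′ (φ z)) (sym (proj₂ leaf-x t e)) (edge-sym G ex)
      ... | no _ | yes refl | yes refl | _ = ⊥-elim (proj₁ Kq (sym (proj₂ leaf-y t e)))
      ... | no _ | yes refl | no _ | yes refl = ⊥-elim (edge-irrefl F e)
      ... | no _ | yes refl | no _ | no _ = subst (λ z → Edge G y′ (φ z)) (sym (proj₂ leaf-y t e)) (edge-sym G ey)
      ... | no _ | no _ | yes refl | _ = subst (λ z → Edge G (φ z) x′) (sym (proj₂ leaf-x s (edge-sym F e))) ex
      ... | no _ | no _ | no _ | yes refl = subst (λ z → Edge G (φ z) y′) (sym (proj₂ leaf-y s (edge-sym F e))) ey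
      ... | no a | no b | no a′ | no b′ = off-hom off (a , b) (a′ , b′) e

  completable-twins : ∀ {u} → ¬ Embeds F G → x ≢ y → Leaf F x u → Leaf F y u → Completable F G x y u
  completable-twins ne x≢y lx ly off o≢ u₁ u₂ e₁ e₂ = ne (add-leaves x≢y lx ly K K off o≢ u₁ u₂ e₁ e₂)
    where K = (edge-≢ F (edge-sym F (proj₁ lx))) , (edge-≢ F (edge-sym F (proj₁ ly)))

module _ {d m : ℕ} {F : Graph (3 + d)} {G : Graph m} {x y u : Fin (3 + d)} {p q : Fin (3 + d)}
         (acyclic : ¬ HasCycle F) (connected : Connected F) (δ : ∀ v → d ≤ deg G v)
         (x≢y : x ≢ y) (leaf-x : Leaf F x p) (leaf-y : Leaf F y q) (cmp : Completable F G x y u) where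

  size : ∀ {L} → Partial F G L → x ∉ dom F G L → y ∉ dom F G L → length L ≤ suc d
  size {L} P x∉ y∉ = ≤-pred (≤-pred (subst (λ k → 2 + k ≤ 3 + d) (length-map proj₁ L) (unique-length≤
    (cons-unique (λ { (here e) → x≢y e ; (there x∈) → x∉ x∈ }) (cons-unique y∉ (dom-unique F G P))))))

  -- An embedding of F minus x, y has d + 1 vertices in its image; as those of N are not adjacent to v,
  -- at least deg v ∸ d + |N| ≥ 2 neighbours of v stay unused.
  spread : ∀ {L v} (N : List (Fin m)) → Partial F G L → (u , v) ∈ L →
           x ∉ dom F G L → y ∉ dom F G L → Unique N → (∀ {b} → b ∈ N → b ∈ ran F G L × b ≢ v × ¬ Edge G v b) →
           2 + d ≤ length N + deg G v → ⊥
  spread {L} {v} N P u∈ x∉ y∉ uN hN large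
    with extend F G connected δ leaf-x leaf-y (suc d ∸ length L) P u∈ x∉ y∉ (m+[n∸m]≡n (size P x∉ y∉))
  ... | L′ , P′ , sub , len , x∉′ , y∉′ = cmp off (λ e → proj₂ (proj₂ second) (here (sym e)))
      (unused first∉) (unused (λ o∈ → proj₂ (proj₂ second) (there o∈)))
      (edge first∉ (proj₁ (proj₂ first))) (edge (λ o∈ → proj₂ (proj₂ second) (there o∈)) (proj₁ (proj₂ second)))
    where
    φ = toFun F G P′
    -- `x`, `y` and the `d + 1` vertices of the domain are `d + 3` distinct vertices, so they
    -- exhaust `F`.
    kept : ∀ {t} → Kept F G x y t → t ∈ dom F G L′
    kept {t} (t≢x , t≢y) with unique-⊆-full
      (cons-unique (λ { (here e) → x≢y e ; (there x∈) → x∉′ x∈ }) (cons-unique y∉′ (dom-unique F G P′)))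
      (λ {z} _ → ∈-allFin z) (≤-reflexive (trans (length-allFin (3 + d)) (cong (2 +_) (sym (trans (length-map proj₁ L′) len))))) (∈-allFin t)
    ... | here e = ⊥-elim (t≢x e)
    ... | there (here e) = ⊥-elim (t≢y e)
    ... | there (there t∈) = t∈
    off : Off F G x y φ
    off = record
      { off-inj = λ {s} {t} Ks Kt e → injective F G P′ (toFun-∈ F G P′ (kept Ks))
                    (subst (λ b → (t , b) ∈ L′) (sym e) (toFun-∈ F G P′ (kept Kt)))
      ; off-hom = λ Ks Kt → homomorphic F G acyclic P′ (toFun-∈ F G P′ (kept Ks)) (toFun-∈ F G P′ (kept Kt)) }
    unused : ∀ {o} → o ∉ ran F G L′ → Unused F G x y φ o
    unused o∉ Kt refl = o∉ (∈-map⁺ proj₂ (toFun-∈ F G P′ (kept Kt)))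
    -- These are at least `d + 3` distinct vertices, while the image has `d + 1`. The two left over
    -- are neighbours of `v`, because `v` and `N` belong to the image.
    xs = v ∷ (N ++ nbrs G v)
    xs-unique : Unique xs
    xs-unique = cons-unique (λ v∈ → [ (λ v∈N → proj₁ (proj₂ (hN v∈N)) refl) , ∉nbrs-self G ]′ (∈-++⁻ N v∈))
      (Uniq.++⁺ uN (nbrs-unique G v) λ (b∈N , b∈) → proj₂ (proj₂ (hN b∈N)) (∈nbrs⁻ G b∈))
    ran-len : length (ran F G L′) ≡ suc d
    ran-len = trans (length-map proj₂ L′) len
    xs-len : 3 + d ≤ length xs
    xs-len = s≤s (subst (2 + d ≤_) (sym (trans (length-++ N) (cong (length N +_) (length-nbrs G v)))) large)
    first : ∃ λ o → o ∈ xs × o ∉ ran F G L′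
    first = fresh (ran F G L′) xs-unique (≤-trans (s≤s (≤-trans (≤-reflexive ran-len) (n≤1+n _))) xs-len)
    first∉ = proj₂ (proj₂ first)
    second : ∃ λ o → o ∈ xs × o ∉ proj₁ first ∷ ran F G L′
    second = fresh (proj₁ first ∷ ran F G L′) xs-unique (≤-trans (s≤s (s≤s (≤-reflexive ran-len))) xs-len)
    lift : ∀ {b} → b ∈ ran F G L → b ∈ ran F G L′
    lift b∈ with ∈-map⁻ proj₂ b∈
    ... | _ , ∈L , refl = ∈-map⁺ proj₂ (sub ∈L)
    edge : ∀ {o} → o ∉ ran F G L′ → o ∈ xs → Edge G (φ u) o
    edge {o} o∉ o∈ = subst (λ w → Edge G w o) (sym (toFun-≡ F G P′ (sub u∈))) (go o∈)
      where
      go : o ∈ xs → Edge G v o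
      go (here refl) = ⊥-elim (o∉ (lift (∈-map⁺ proj₂ u∈)))
      go (there o∈) = [ (λ o∈N → ⊥-elim (o∉ (lift (proj₁ (hN o∈N))))) , ∈nbrs⁻ G ]′ (∈-++⁻ N o∈)

-- Trees with two pendant paths

module _ {d m : ℕ} {F : Graph (3 + d)} {G : Graph m} {x y u w p q : Fin (3 + d)}
         (2≤d : 2 ≤ d) (δ : ∀ v → d ≤ deg G v) (ne : ¬ Embeds F G)
         (x≢y : x ≢ y) (leaf-x : Leaf F x u) (leaf-y : Leaf F y w)
         (nbrs-u : ∀ z → Edge F u z → z ≡ x ⊎ z ≡ p) (nbrs-w : ∀ z → Edge F w z → z ≡ y ⊎ z ≡ q)
         (u≢w : u ≢ w) (q≢w : q ≢ w) (q≢u : q ≢ u) (p≢u : p ≢ u)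
         (Ku : Kept F G x y u) (Kp : Kept F G x y p) (Kw : Kept F G x y w) (Kq : Kept F G x y q) where
  open Off

  private
    Kept′ : Fin (3 + d) → Set
    Kept′ = Kept F G x y

    kept? : Decidable Kept′
    kept? t = ¬? (t ≟ x) ×-dec ¬? (t ≟ y)

    keptL : List (Fin (3 + d))
    keptL = filter kept? (allFin (3 + d))

    ∈keptL⁺ : ∀ {t} → Kept′ t → t ∈ keptL
    ∈keptL⁺ K = ∈-filter⁺ kept? (∈-allFin _) K

    ∈keptL⁻ : ∀ {t} → t ∈ keptL → Kept′ t
    ∈keptL⁻ t∈ = proj₂ (∈-filter⁻ kept? {xs = allFin (3 + d)} t∈)

    keptL-length : length keptL ≤ suc d
    keptL-length = ≤-pred (≤-pred (unique-length≤ (cons-unique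
      (λ { (here e) → x≢y e ; (there x∈) → proj₁ (∈keptL⁻ x∈) refl })
      (cons-unique (λ y∈ → proj₂ (∈keptL⁻ y∈) refl) (Uniq.filter⁺ kept? (Uniq.allFin⁺ (3 + d)))))))

    -- Such a φ t has all its neighbours in the image, so N[φ t] is the whole image.
    Saturated : (Fin (3 + d) → Fin m) → Fin (3 + d) → Set
    Saturated φ t = (∀ {b} → Edge G (φ t) b → ¬ Unused F G x y φ b) × (∀ {s} → Kept′ s → s ≢ t → Edge G (φ t) (φ s))

    module _ {o₁ o₂ : Fin m} (o₁≢o₂ : o₁ ≢ o₂) where

      -- A free neighbour of `φ w` could receive `y`, with one of `o₁`, `o₂` still left for `x`. So
      -- `φ w` has at least `d` neighbours inside an image of at most `d + 1` vertices, and is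
      -- adjacent to all the others.
      saturated-w : ∀ {φ} → Off F G x y φ → Unused F G x y φ o₁ → Unused F G x y φ o₂ →
                    Edge G (φ u) o₁ → Edge G (φ u) o₂ → Saturated φ w
      saturated-w {φ} off un₁ un₂ e₁ e₂ = sat , λ {s} Ks s≢w → adjacent Ks s≢w
        where
        sat : ∀ {b} → Edge G (φ w) b → ¬ Unused F G x y φ b
        sat {b} e ub with b ≟ o₁
        ... | no b≢ = ne (add-leaves x≢y leaf-x leaf-y Ku Kw off (b≢ ∘ sym) un₁ ub e₁ e)
        ... | yes refl = ne (add-leaves x≢y leaf-x leaf-y Ku Kw off (o₁≢o₂ ∘ sym) un₂ ub e₂ e)
        image = map φ keptL
        covered : ∀ {b} → b ∈ φ w ∷ nbrs G (φ w) → b ∈ image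
        covered (here refl) = ∈-map⁺ φ (∈keptL⁺ Kw)
        covered {b} (there b∈) = decidable-stable (b ∈? image) λ b∉ →
          sat (∈nbrs⁻ G b∈) λ { Kt refl → b∉ (∈-map⁺ φ (∈keptL⁺ Kt)) }
        adjacent : ∀ {s} → Kept′ s → s ≢ w → Edge G (φ w) (φ s)
        adjacent Ks s≢w with unique-⊆-full (cons-unique (∉nbrs-self G) (nbrs-unique G (φ w))) covered
          (subst (_≤ suc (length (nbrs G (φ w)))) (sym (length-map φ keptL))
            (≤-trans keptL-length (s≤s (subst (d ≤_) (sym (length-nbrs G (φ w))) (δ (φ w)))))) (∈-map⁺ φ (∈keptL⁺ Ks))
        ... | here e = ⊥-elim (s≢w (off-inj off Ks Kw e))
        ... | there φs∈ = ∈nbrs⁻ G φs∈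

      module _ {φ : Fin (3 + d) → Fin m} (off : Off F G x y φ)
               (un₁ : Unused F G x y φ o₁) (un₂ : Unused F G x y φ o₂)
               (e₁ : Edge G (φ u) o₁) (e₂ : Edge G (φ u) o₂) where

        -- φ w is adjacent to the rest of the image, so w may change places with any t for which φ t ~ φ q or t = q.
        saturated-swap : ∀ {t} → Kept′ t → t ≢ w → t ≢ u → (t ≡ q ⊎ Edge G (φ t) (φ q)) → Saturated φ t
        saturated-swap {t} Kt t≢w t≢u tq =
          (λ e ub → proj₁ sat (subst (λ v → Edge G v _) (sym ψw) e) (unused ub)) , adjacent
          where
          c~ = proj₂ (saturated-w off un₁ un₂ e₁ e₂)
          σ : Fin (3 + d) → Fin (3 + d)
          σ z with z ≟ w | z ≟ t
          ... | yes _ | _ = t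
          ... | no _ | yes _ = w
          ... | no _ | no _ = z
          Kσ : ∀ {z} → Kept′ z → Kept′ (σ z)
          Kσ {z} Kz with z ≟ w | z ≟ t
          ... | yes _ | _ = Kt
          ... | no _ | yes _ = Kw
          ... | no _ | no _ = Kz
          σ-inj : ∀ {r s} → σ r ≡ σ s → r ≡ s
          σ-inj {r} {s} e with r ≟ w | r ≟ t | s ≟ w | s ≟ t
          ... | yes refl | _ | yes refl | _ = refl
          ... | yes _ | _ | no _ | yes _ = ⊥-elim (t≢w e)
          ... | yes _ | _ | no _ | no b = ⊥-elim (b (sym e))
          ... | no _ | yes _ | yes _ | _ = ⊥-elim (t≢w (sym e))
          ... | no _ | yes refl | no _ | yes refl = refl
          ... | no _ | yes _ | no a | no _ = ⊥-elim (a (sym e))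
          ... | no _ | no b | yes _ | _ = ⊥-elim (b e)
          ... | no a | no _ | no _ | yes _ = ⊥-elim (a e)
          ... | no _ | no _ | no _ | no _ = e
          ψ = φ ∘ σ
          ψw : ψ w ≡ φ t
          ψw with w ≟ w
          ... | yes _ = refl
          ... | no ¬r = ⊥-elim (¬r refl)
          ψ-other : ∀ {s} → s ≢ w → s ≢ t → ψ s ≡ φ s
          ψ-other {s} a b with s ≟ w | s ≟ t
          ... | yes e | _ = ⊥-elim (a e)
          ... | no _ | yes e = ⊥-elim (b e)
          ... | no _ | no _ = refl
          w-edge′ : t ≡ q ⊎ Edge G (φ t) (φ q) → ∀ {s} → Kept′ s → s ≢ t → Edge F w s → Edge G (φ t) (φ s)
          w-edge′ tq {s} Ks s≢t e with nbrs-w s e | tq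
          ... | inj₁ s≡y | _ = ⊥-elim (proj₂ Ks s≡y)
          ... | inj₂ refl | inj₁ t≡q = ⊥-elim (s≢t (sym t≡q))
          ... | inj₂ refl | inj₂ e′ = e′
          w-edge = w-edge′ tq
          hom : ∀ {r s} → Kept′ r → Kept′ s → Edge F r s → Edge G (ψ r) (ψ s)
          hom {r} {s} Kr Ks e with r ≟ w | r ≟ t | s ≟ w | s ≟ t
          ... | yes refl | _ | yes refl | _ = ⊥-elim (edge-irrefl F e)
          ... | yes refl | _ | no _ | yes refl = edge-sym G (c~ Kt t≢w)
          ... | yes refl | _ | no _ | no b = w-edge Ks b e
          ... | no _ | yes refl | yes refl | _ = c~ Kt t≢w
          ... | no _ | yes refl | no _ | yes refl = ⊥-elim (edge-irrefl F e)
          ... | no _ | yes refl | no a | no _ = c~ Ks a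
          ... | no _ | no b | yes refl | _ = edge-sym G (w-edge Kr b (edge-sym F e))
          ... | no a | no _ | no _ | yes refl = edge-sym G (c~ Kr a)
          ... | no _ | no _ | no _ | no _ = off-hom off Kr Ks e
          unused : ∀ {o} → Unused F G x y φ o → Unused F G x y ψ o
          unused uo Kz e = uo (Kσ Kz) e
          ψu : ψ u ≡ φ u
          ψu = ψ-other u≢w (t≢u ∘ sym)
          sat : Saturated ψ w
          sat = saturated-w
            (record { off-inj = λ Kr Ks e → σ-inj (off-inj off (Kσ Kr) (Kσ Ks) e) ; off-hom = hom })
            (unused un₁) (unused un₂) (subst (λ v → Edge G v o₁) (sym ψu) e₁) (subst (λ v → Edge G v o₂) (sym ψu) e₂)
          adjacent : ∀ {s} → Kept′ s → s ≢ t → Edge G (φ t) (φ s)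
          adjacent {s} Ks s≢t with s ≟ w
          ... | yes refl = edge-sym G (c~ Kt t≢w)
          ... | no s≢w = subst₂ (Edge G) ψw (ψ-other s≢w s≢t) (proj₂ sat Ks s≢w)

        -- `q` has to be treated before the other vertices: exchanging it with `w` asks for no edge,
        -- and once `φ q` is adjacent to the whole image, every remaining `t` meets the edge
        -- condition.
        saturated : ∀ {t} → Kept′ t → t ≢ u → Saturated φ t
        saturated {t} Kt t≢u with t ≟ w | t ≟ q
        ... | yes refl | _ = saturated-w off un₁ un₂ e₁ e₂
        ... | no t≢w | yes refl = saturated-swap Kt t≢w t≢u (inj₁ refl)
        ... | no t≢w | no t≢q = saturated-swap Kt t≢w t≢u
          (inj₂ (edge-sym G (proj₂ (saturated-swap Kq q≢w q≢u (inj₁ refl)) Kt t≢q)))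

        -- The image is now a clique attached to the rest of G at φ u only: move p to φ u and u, x out of the clique.
        clique-embeds : Embeds F G
        clique-embeds with fresh (φ u ∷ []) (nbrs-unique G o₁) (subst (2 ≤_) (sym (length-nbrs G o₁)) (≤-trans 2≤d (δ o₁)))
        ... | o′ , o′∈ , o′∉ = ψ , inj , hom
          where
          o₁~o′ : Edge G o₁ o′
          o₁~o′ = ∈nbrs⁻ G o′∈
          un′ : Unused F G x y φ o′
          un′ {t} Kt refl with t ≟ u
          ... | yes refl = o′∉ (here refl)
          ... | no t≢u = proj₁ (saturated Kt t≢u) (edge-sym G o₁~o′) un₁
          adjacent : ∀ {s t} → Kept′ s → Kept′ t → s ≢ t → Edge G (φ s) (φ t)
          adjacent {s} {t} Ks Kt s≢t with s ≟ u
          ... | no s≢u = proj₂ (saturated Ks s≢u) Kt (s≢t ∘ sym)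
          ... | yes refl = edge-sym G (proj₂ (saturated Kt (s≢t ∘ sym)) Ks s≢t)
          -- `p` moves to the place of `u`, and `y` takes the place that `p` leaves; inside a clique
          -- no edge can be lost by this.
          κ : Fin (3 + d) → Fin (3 + d)
          κ z with z ≟ y | z ≟ p
          ... | yes _ | _ = p
          ... | no _ | yes _ = u
          ... | no _ | no _ = z
          Kκ : ∀ {z} → z ≢ x → Kept′ (κ z)
          Kκ {z} z≢x with z ≟ y | z ≟ p
          ... | yes _ | _ = Kp
          ... | no _ | yes _ = Ku
          ... | no z≢y | no _ = z≢x , z≢y
          κ-inj : ∀ {r s} → r ≢ u → s ≢ u → κ r ≡ κ s → r ≡ s
          κ-inj {r} {s} r≢u s≢u e with r ≟ y | r ≟ p | s ≟ y | s ≟ p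
          ... | yes refl | _ | yes refl | _ = refl
          ... | yes _ | _ | no _ | yes _ = ⊥-elim (p≢u e)
          ... | yes _ | _ | no _ | no b = ⊥-elim (b (sym e))
          ... | no _ | yes _ | yes _ | _ = ⊥-elim (p≢u (sym e))
          ... | no _ | yes refl | no _ | yes refl = refl
          ... | no _ | yes _ | no _ | no _ = ⊥-elim (s≢u (sym e))
          ... | no _ | no b | yes _ | _ = ⊥-elim (b e)
          ... | no _ | no _ | no _ | yes _ = ⊥-elim (r≢u e)
          ... | no _ | no _ | no _ | no _ = e
          κp : κ p ≡ u
          κp with p ≟ y | p ≟ p
          ... | yes e | _ = ⊥-elim (proj₂ Kp e)
          ... | no _ | yes _ = refl
          ... | no _ | no ¬r = ⊥-elim (¬r refl)
          ψ : Fin (3 + d) → Fin m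
          ψ z with z ≟ x | z ≟ u
          ... | yes _ | _ = o′
          ... | no _ | yes _ = o₁
          ... | no _ | no _ = φ (κ z)
          inj : Injective _≡_ _≡_ ψ
          inj {r} {s} e with r ≟ x | r ≟ u | s ≟ x | s ≟ u
          ... | yes refl | _ | yes refl | _ = refl
          ... | yes _ | _ | no _ | yes _ = ⊥-elim (edge-≢ G o₁~o′ (sym e))
          ... | yes _ | _ | no a | no _ = ⊥-elim (un′ (Kκ a) (sym e))
          ... | no _ | yes _ | yes _ | _ = ⊥-elim (edge-≢ G o₁~o′ e)
          ... | no _ | yes refl | no _ | yes refl = refl
          ... | no _ | yes _ | no a | no _ = ⊥-elim (un₁ (Kκ a) (sym e))
          ... | no a | no _ | yes _ | _ = ⊥-elim (un′ (Kκ a) e)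
          ... | no a | no _ | no _ | yes _ = ⊥-elim (un₁ (Kκ a) e)
          ... | no a | no b | no a′ | no b′ = κ-inj b b′ (off-inj off (Kκ a) (Kκ a′) e)
          u-edge : ∀ {s} → s ≢ x → Edge F u s → Edge G o₁ (φ (κ s))
          u-edge {s} s≢x e with nbrs-u s e
          ... | inj₁ s≡x = ⊥-elim (s≢x s≡x)
          ... | inj₂ refl = subst (λ v → Edge G o₁ (φ v)) (sym κp) (edge-sym G e₁)
          hom : ∀ r s → Edge F r s → Edge G (ψ r) (ψ s)
          hom r s e with r ≟ x | r ≟ u | s ≟ x | s ≟ u
          ... | yes refl | _ | yes refl | _ = ⊥-elim (edge-irrefl F e)
          ... | yes refl | _ | no _ | yes _ = edge-sym G o₁~o′
          ... | yes refl | _ | no _ | no b = ⊥-elim (b (proj₂ leaf-x s e))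
          ... | no _ | yes _ | yes refl | _ = o₁~o′
          ... | no _ | yes refl | no _ | yes refl = ⊥-elim (edge-irrefl F e)
          ... | no _ | yes refl | no a | no _ = u-edge a e
          ... | no _ | no b | yes refl | _ = ⊥-elim (b (proj₂ leaf-x r (edge-sym F e)))
          ... | no a | no _ | no _ | yes refl = edge-sym G (u-edge a (edge-sym F e))
          ... | no a | no b | no a′ | no b′ = adjacent (Kκ a) (Kκ a′) λ eq → edge-≢ F e (κ-inj b b′ eq)

  completable-legs : Completable F G x y u
  completable-legs off o≢ u₁ u₂ e₁ e₂ = ne (clique-embeds o≢ off u₁ u₂ e₁ e₂)

-- Regular graphs

Far : ∀ {m} → Graph m → Fin m → Fin m → Set
Far G v b = b ≢ v × ¬ Edge G v b

module _ {m : ℕ} (G : Graph m) (connected : Connected G) where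

  -- Without such forks, all neighbours of the first vertex `v` of an induced path `v`, `a`, `b`
  -- turn out to be adjacent to `b`, and regularity makes the neighbourhoods of `v` and `b` equal.
  -- Each vertex in it has `b` as its only far neighbour, so these `d + 2` vertices are closed under
  -- adjacency, too few for the connected `G`.
  fork : ∀ {d} → (∀ v → deg G v ≡ d) → 3 ≤ d → 3 + d ≤ m →
         (∀ {v a b b′} → Edge G v a → Edge G a b → Edge G a b′ → b ≢ b′ → Far G v b → Far G v b′ → ⊥) → ⊥
  fork {d} reg 3≤d 3+d≤m noFork with fresh [] (Uniq.allFin⁺ m) (subst (0 <_) (sym (length-allFin m)) (≤-trans (s≤s z≤n) 3+d≤m))
  ... | v , _ , _ with induced-path G connected v (subst (λ k → suc k < m) (sym (reg v)) (≤-trans (n≤1+n _) 3+d≤m))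
  ... | a , b , va , ab , b≢v , v≁b =
    <⇒≱ 3+d≤m (subst (λ k → m ≤ 2 + k) (trans (length-nbrs G v) (reg v)) (closed-length G connected (v ∷ b ∷ nbrs G v) (here refl) cl))
    where
    single : ∀ {v a b b′} → Edge G v a → Edge G a b → Edge G a b′ → Far G v b → Far G v b′ → b ≡ b′
    single {b = b} {b′} va ab ab′ f f′ with b ≟ b′
    ... | yes e = e
    ... | no ne = ⊥-elim (noFork va ab ab′ ne f f′)
    far : ∀ {v w} → w ≢ v → ¬ Edge G w v → Far G w v
    far w≢v nwv = w≢v ∘ sym , nwv
    b-v : Far G b v
    b-v = b≢v ∘ sym , v≁b ∘ edge-sym G
    adj-b : ∀ {w} → Edge G v w → Edge G w b
    adj-b {w} vw = decidable-stable (edge? G w b) λ w≁b → contra w≁b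
      where
      -- Three neighbours `a`, `w`, `c` of `v` are compared. Seen from `b`, the vertex `v` is the
      -- only far neighbour allowed to `a`, so `a` is not adjacent to `w`. Then `c` is adjacent to
      -- `b`, or else `v` would have the neighbours `w` and `c` far from `a`. Hence `c`, like `a`,
      -- is not adjacent to `w`, and `v` has the neighbours `a` and `c` far from `w`.
      contra : ¬ Edge G w b → ⊥
      contra w≁b with fresh (a ∷ w ∷ []) (nbrs-unique G v) (subst (3 ≤_) (sym (trans (length-nbrs G v) (reg v))) 3≤d)
      ... | c , c∈ , c∉ = result
        where
        vc = ∈nbrs⁻ G c∈
        w≢b : w ≢ b
        w≢b refl = v≁b vw
        c≢b : c ≢ b
        c≢b refl = v≁b vc
        w≢a : w ≢ a
        w≢a refl = w≁b ab
        a≁w : ¬ Edge G a w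
        a≁w aw = edge-≢ G vw (single (edge-sym G ab) (edge-sym G va) aw b-v (w≢b , w≁b ∘ edge-sym G))
        c~b : Edge G c b
        c~b = decidable-stable (edge? G c b) λ c≁b →
          let a≁c : ¬ Edge G a c
              a≁c ac = edge-≢ G vc (single (edge-sym G ab) (edge-sym G va) ac b-v (c≢b , c≁b ∘ edge-sym G))
          in c∉ (there (here (sym (single (edge-sym G va) vw vc (w≢a , a≁w) ((λ e → c∉ (here e)) , a≁c)))))
        w≁c : ¬ Edge G c w
        w≁c cw = edge-≢ G vw (single (edge-sym G c~b) (edge-sym G vc) cw b-v (w≢b , w≁b ∘ edge-sym G))
        result : ⊥
        result = c∉ (here (sym (single (edge-sym G vw) va vc
          (w≢a ∘ sym , a≁w ∘ edge-sym G) ((λ e → c∉ (there (here e))) , w≁c ∘ edge-sym G))))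
    nbrs-b⊆ : ∀ {t} → Edge G b t → t ∈ nbrs G v
    nbrs-b⊆ bt = unique-⊆-full (nbrs-unique G v) (λ t∈ → ∈nbrs⁺ G (edge-sym G (adj-b (∈nbrs⁻ G t∈))))
      (≤-reflexive (trans (length-nbrs G b) (trans (reg b) (sym (trans (length-nbrs G v) (reg v)))))) (∈nbrs⁺ G bt)
    cl : ∀ {s t} → s ∈ v ∷ b ∷ nbrs G v → Edge G s t → t ∈ v ∷ b ∷ nbrs G v
    cl (here refl) e = there (there (∈nbrs⁺ G e))
    cl (there (here refl)) e = there (there (nbrs-b⊆ e))
    cl {s} {t} (there (there s∈)) e with t ≟ v | edge? G v t
    ... | yes t≡v | _ = here t≡v
    ... | no _ | yes vt = there (there (∈nbrs⁺ G vt))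
    ... | no t≢v | no v≁t = there (here (single (∈nbrs⁻ G s∈) e (adj-b (∈nbrs⁻ G s∈)) (t≢v , v≁t) (b≢v , v≁b)))

  -- The hypothesis says that a vertex at distance two from `v` has all its neighbours among those
  -- of `v`. So no vertex is at distance three, and by connectivity every non-neighbour of `v` is
  -- `v` itself or at distance two.
  twins : (∀ {v a b c} → Edge G v a → Edge G a b → Edge G b c → Far G v b → Far G v c → ⊥) →
          ∀ {v z} → ¬ Edge G v z → ∀ {c} → Edge G z c → Edge G v c
  twins noPath {v} {z} v≁z {c} zc = result (closed G {S} cl (connected v z) (inj₁ refl))
    where
    S : Fin m → Set
    S t = t ≡ v ⊎ (Edge G v t ⊎ ∃ λ a → Edge G v a × Edge G a t × Far G v t)
    second : ∀ {s t a} → Edge G v a → Edge G a s → Far G v s → Edge G s t → Edge G v t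
    second {s} {t} va as f st = decidable-stable (edge? G v t) λ v≁t →
      noPath va as st f ((λ { refl → proj₂ f (edge-sym G st) }) , v≁t)
    cl : ∀ {s t} → S s → Edge G s t → S t
    cl (inj₁ refl) st = inj₂ (inj₁ st)
    cl {s} {t} (inj₂ (inj₁ vs)) st with t ≟ v | edge? G v t
    ... | yes e | _ = inj₁ e
    ... | no _ | yes vt = inj₂ (inj₁ vt)
    ... | no t≢v | no v≁t = inj₂ (inj₂ (s , vs , st , t≢v , v≁t))
    cl (inj₂ (inj₂ (a , va , as , f))) st = inj₂ (inj₁ (second va as f st))
    result : S z → Edge G v c
    result (inj₁ refl) = zc
    result (inj₂ (inj₁ vz)) = ⊥-elim (v≁z vz)
    result (inj₂ (inj₂ (a , va , az , f))) = second va az f zc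

-- Longest paths in a forest

snoc-unique : ∀ {n} {l : List (Fin n)} {x} → Unique l → x ∉ l → Unique (l ++ x ∷ [])
snoc-unique u x∉ = Uniq.++⁺ u ([] ∷ []) λ { (y∈ , here refl) → x∉ y∈ }

reverse-unique : ∀ {n} {l : List (Fin n)} → Unique l → Unique (reverse l)
reverse-unique {l = []} u = u
reverse-unique {l = x ∷ l} u with uncons-unique u
... | x∉ , u′ = subst Unique (sym (unfold-reverse x l))
  (snoc-unique (reverse-unique u′) (x∉ ∘ reverse⁻))

module _ {n : ℕ} (F : Graph n) where

  prefix : ∀ {x z y l} → Path F x z l → Unique l → y ∈ l → ∃ λ l′ → Path F x y l′ × Unique l′ × (∀ {t} → t ∈ l′ → t ∈ l)
  prefix nil u (here refl) = _ , nil , u , id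
  prefix {x} (cons _ _) _ (here refl) = x ∷ [] , nil , [] ∷ [] , λ { (here e) → here e }
  prefix {x} (cons e P) u (there y∈) with uncons-unique u
  ... | x∉ , u′ with prefix P u′ y∈
  ... | l′ , P′ , u″ , sub = x ∷ l′ , cons e P′ , cons-unique (x∉ ∘ sub) u″ ,
        λ { (here e) → here e ; (there t∈) → there (sub t∈) }

  path-head : ∀ {x z l} → Path F x z l → ∃ λ r → l ≡ x ∷ r
  path-head nil = [] , refl
  path-head (cons {l = l} _ _) = l , refl

  Longest : ℕ → Set
  Longest k = ∀ {x z l} → Path F x z l → Unique l → length l ≤ k

  -- In continuation form, because `em` settles whether a path can be beaten. The search ends since
  -- a path has at most `n` vertices; `k` bounds the room left.
  longest-path : Fin n → (∀ {x z l} → Path F x z l → Unique l → Longest (length l) → ⊥) → ⊥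
  longest-path v h = search n (nil {x = v}) ([] ∷ []) (m≤n+m n 1)
    where
    search : ∀ k {x z l} → Path F x z l → Unique l → n ≤ length l + k → ⊥
    search zero {l = l} P u le = h P u λ P′ u′ → ≤-trans (unique-length≤ u′) (subst (n ≤_) (+-identityʳ (length l)) le)
    search (suc k) {l = l} P u le = em {∃ λ x → ∃ λ z → ∃ λ l′ → Path F x z l′ × Unique l′ × length l < length l′} λ
      { (inj₁ (_ , _ , l′ , P′ , u′ , lt)) → search k P′ u′
          (≤-trans (subst (n ≤_) (+-suc (length l) k) le) (+-monoˡ-≤ k lt))
      ; (inj₂ none) → h P u λ P′ u′ → ≮⇒≥ λ lt → none (_ , _ , _ , P′ , u′ , lt) }

  module _ (acyclic : ¬ HasCycle F) where

    chordless : ∀ {x y z l} → Path F y z l → Unique l → x ∉ l → Edge F x y → Edge F x z → y ≡ z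
    chordless nil _ _ _ _ = refl
    chordless P@(cons _ nil) u x∉ xy xz = ⊥-elim (acyclic (path-cycle F (cons xy P) (cons-unique x∉ u) xz))
    chordless P@(cons _ (cons _ _)) u x∉ xy xz = ⊥-elim (acyclic (path-cycle F (cons xy P) (cons-unique x∉ u) xz))

    chordless-∈ : ∀ {x y z t l} → Path F y t l → Unique l → x ∉ l → Edge F x y → Edge F x z → z ∈ l → y ≡ z
    chordless-∈ P u x∉ xy xz z∈ with prefix P u z∈
    ... | _ , P′ , u′ , sub = chordless P′ u′ (x∉ ∘ sub) xy xz

    -- Another neighbour would either prolong the path or lie on it and close a cycle.
    end-leaf : ∀ {x u z l} → Edge F x u → Path F u z l → Unique (x ∷ l) → Longest (suc (length l)) → Leaf F x u
    end-leaf {x} {u} {l = l} xu P uq max with uncons-unique uq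
    ... | x∉ , u′ = xu , only
      where
      only : ∀ t → Edge F x t → t ≡ u
      only t xt with t ∈? (x ∷ l)
      ... | yes (here refl) = ⊥-elim (edge-irrefl F xt)
      ... | yes (there t∈) = sym (chordless-∈ P u′ x∉ xu xt t∈)
      ... | no t∉ = ⊥-elim (1+n≰n (max (cons (edge-sym F xt) (cons xu P)) (cons-unique t∉ uq)))

    -- Replacing `x` by `t` gives a path of the same length, so `t` is the end of a longest path
    -- too.
    end-leaves : ∀ {x u p z l} → Edge F x u → Edge F u p → Path F p z l → Unique (x ∷ u ∷ l) → Longest (2 + length l) →
                 ∀ t → Edge F u t → t ≢ p → Leaf F t u
    end-leaves {x} {u} {p} {l = l} xu up P uq max t ut t≢p with uncons-unique uq
    ... | _ , uq′ with uncons-unique uq′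
    ... | u∉ , uq″ with t ∈? (u ∷ l)
    ... | yes (here refl) = ⊥-elim (edge-irrefl F ut)
    ... | yes (there t∈) = ⊥-elim (t≢p (sym (chordless-∈ P uq″ u∉ up ut t∈)))
    ... | no t∉ = end-leaf (edge-sym F ut) (cons up P) (cons-unique t∉ uq′) max

-- Complete multipartite graphs

≅-from : ∀ {a b} (A : Graph a) (B : Graph b) (σ : Fin b → Fin a) (τ : Fin a → Fin b) →
         (∀ {i j} → σ i ≡ σ j → i ≡ j) → (∀ x → σ (τ x) ≡ x) →
         (∀ i j → adj A (σ i) (σ j) ≡ adj B i j) → A ≅ B
≅-from A B σ τ inj στ h = mk↔ₛ′ τ σ (λ i → inj (στ (σ i))) στ ,
  λ x y → trans (cong₂ (adj A) (sym (στ x)) (sym (στ y))) (h (τ x) (τ y))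

cast-injective : ∀ {b c} (eq : b ≡ c) {i j : Fin b} → cast eq i ≡ cast eq j → i ≡ j
cast-injective refl {i} {j} e = trans (sym (cast-is-id refl i)) (trans e (cast-is-id refl j))

cast-cast : ∀ {b c} (eq : b ≡ c) (eq′ : c ≡ b) i → cast eq (cast eq′ i) ≡ i
cast-cast refl eq′ i = trans (cast-is-id refl _) (cast-is-id eq′ i)

-- Symmetrising and removing the diagonal, as `simple` does, leaves this relation unchanged.
multipartite-adj : ∀ r s (x y : Fin (r * s)) →
                   adj (CompleteMultipartite r s) x y ≡ not ⌊ quotient {r} s x ≟ quotient {r} s y ⌋
multipartite-adj r s x y with quotient {r} s x ≟ quotient {r} s y | quotient {r} s y ≟ quotient {r} s x | x ≟ y
... | yes e | no ne | _ = ⊥-elim (ne (sym e))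
... | no ne | yes e | _ = ⊥-elim (ne (sym e))
... | yes _ | yes _ | yes _ = refl
... | yes _ | yes _ | no _ = refl
... | no ne | no _ | yes refl = ⊥-elim (ne refl)
... | no _ | no _ | no _ = refl

length-partition : ∀ {A : Set} {P : A → Set} (P? : Decidable P) (l : List A) →
                   length (filter (¬? ∘ P?) l) + length (filter P? l) ≡ length l
length-partition P? [] = refl
length-partition P? (x ∷ l) with P? x
... | yes _ = trans (+-suc _ _) (cong suc (length-partition P? l))
... | no _ = cong suc (length-partition P? l)

module _ {m : ℕ} (G : Graph m) (twin : ∀ {v z} → ¬ Edge G v z → ∀ {c} → Edge G z c → Edge G v c) where

  -- Includes `v` itself, so that this becomes the part of `v` in the multipartite graph.
  part : Fin m → List (Fin m)
  part v = filter (¬? ∘ edge? G v) (allFin m)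

  ∈part⁺ : ∀ {v z} → ¬ Edge G v z → z ∈ part v
  ∈part⁺ {v} e = ∈-filter⁺ (¬? ∘ edge? G v) (∈-allFin _) e

  ∈part⁻ : ∀ {v z} → z ∈ part v → ¬ Edge G v z
  ∈part⁻ {v} z∈ = proj₂ (∈-filter⁻ (¬? ∘ edge? G v) {xs = allFin m} z∈)

  part-unique : ∀ v → Unique (part v)
  part-unique v = Uniq.filter⁺ (¬? ∘ edge? G v) (Uniq.allFin⁺ m)

  length-part : ∀ v → length (part v) + deg G v ≡ m
  length-part v = trans (cong (length (part v) +_) (sym (length-nbrs G v)))
    (trans (length-partition (edge? G v) (allFin m)) (length-allFin m))

  nonadj-sym : ∀ {v z} → ¬ Edge G v z → ¬ Edge G z v
  nonadj-sym ne e = ne (edge-sym G e)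

  -- The twin property turns non-adjacency into an equivalence relation, whose classes will be the
  -- parts.
  nonadj-trans : ∀ {v z t} → ¬ Edge G v z → ¬ Edge G z t → ¬ Edge G v t
  nonadj-trans vz zt vt = zt (twin (nonadj-sym vz) vt)

  -- `L` laid out as an array with `r` rows of length `a`, each row a class of non-adjacency.
  record Parts (a : ℕ) (L : List (Fin m)) : Set where
    field
      r    : ℕ
      B    : Fin r → Fin a → Fin m
      same : ∀ i j j′ → ¬ Edge G (B i j) (B i j′)
      diff : ∀ {i i′} j j′ → i ≢ i′ → Edge G (B i j) (B i′ j′)
      inj  : ∀ i {j j′} → B i j ≡ B i j′ → j ≡ j′
      B∈   : ∀ i j → B i j ∈ L
      onto : ∀ {z} → z ∈ L → ∃₂ λ i j → B i j ≡ z

  -- The class of `z` is split off. What is left of `L` are the neighbours of `z`; this is shorter,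
  -- as `z` is not its own neighbour, and again a union of classes.
  parts : ∀ {a} → (∀ v → length (part v) ≡ a) → ∀ k (L : List (Fin m)) → length L ≤ k →
          (∀ {s t} → s ∈ L → ¬ Edge G s t → t ∈ L) → Parts a L
  parts len k [] _ cl = record
    { r = 0 ; B = λ () ; same = λ () ; diff = λ { {()} } ; inj = λ () ; B∈ = λ () ; onto = λ () }
  parts {a} len (suc k) L@(z ∷ L₀) (s≤s le) cl = record
    { r = suc (Parts.r rec) ; B = B ; same = same ; diff = diff ; inj = inj ; B∈ = B∈ ; onto = onto }
    where
    L′ = filter (edge? G z) L
    shorter : length L′ ≤ k
    shorter = subst (λ l → length l ≤ k) (sym (filter-reject (edge? G z) {xs = L₀} (edge-irrefl G {z})))
      (≤-trans (length-filter (edge? G z) L₀) le)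
    L′⁻ : ∀ {t} → t ∈ L′ → t ∈ L × Edge G z t
    L′⁻ = ∈-filter⁻ (edge? G z)
    rec = parts len k L′ shorter λ {s} {t} s∈ st → ∈-filter⁺ (edge? G z) (cl (proj₁ (L′⁻ s∈)) st)
      (decidable-stable (edge? G z t) λ zt → nonadj-trans {z} {t} {s} zt (nonadj-sym st) (proj₂ (L′⁻ s∈)))
    module R = Parts rec
    B : Fin (suc R.r) → Fin a → Fin m
    B zero j = lookup (part z) (cast (sym (len z)) j)
    B (suc i) j = R.B i j
    row : ∀ j → ¬ Edge G z (B zero j)
    row j = ∈part⁻ (∈-lookup {xs = part z} (cast (sym (len z)) j))
    same : ∀ i j j′ → ¬ Edge G (B i j) (B i j′)
    same zero j j′ = nonadj-trans (nonadj-sym (row j)) (row j′)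
    same (suc i) = R.same i
    cross : ∀ i j j′ → Edge G (B zero j) (B (suc i) j′)
    cross i j j′ = twin (nonadj-sym (row j)) (proj₂ (L′⁻ (R.B∈ i j′)))
    diff : ∀ {i i′} j j′ → i ≢ i′ → Edge G (B i j) (B i′ j′)
    diff {zero} {zero} j j′ ne = ⊥-elim (ne refl)
    diff {zero} {suc i′} j j′ ne = cross i′ j j′
    diff {suc i} {zero} j j′ ne = edge-sym G (cross i j′ j)
    diff {suc i} {suc i′} j j′ ne = R.diff j j′ (ne ∘ cong suc)
    inj : ∀ i {j j′} → B i j ≡ B i j′ → j ≡ j′
    inj zero {j} {j′} e = cast-injective (sym (len z)) (lookup-injective (part-unique z) _ _ e)
    inj (suc i) = R.inj i
    B∈ : ∀ i j → B i j ∈ L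
    B∈ zero j = cl (here refl) (row j)
    B∈ (suc i) j = proj₁ (L′⁻ (R.B∈ i j))
    onto : ∀ {t} → t ∈ L → ∃₂ λ i j → B i j ≡ t
    onto {t} t∈ with edge? G z t
    ... | yes zt = let i , j , e = R.onto (∈-filter⁺ (edge? G z) t∈ zt) in suc i , j , e
    ... | no z≁t = zero , cast (len z) (index t∈′) , trans (cong (lookup (part z)) (cast-cast (sym (len z)) (len z) (index t∈′))) (sym (lookup-index t∈′))
      where
      t∈′ = ∈part⁺ z≁t

  multipartite : ∀ {a} → (∀ v → length (part v) ≡ a) → ∃ λ r → G ≅ CompleteMultipartite r a
  multipartite {a} len = R.r , ≅-from G (CompleteMultipartite R.r a) σ τ (λ {i} {j} → σ-inj {i} {j}) στ h
    where
    module R = Parts (parts len m (allFin m) (≤-reflexive (length-allFin m)) (λ _ _ → ∈-allFin _))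
    σ : Fin (R.r * a) → Fin m
    σ x = R.B (quotient {R.r} a x) (remainder {R.r} a x)
    τ : Fin m → Fin (R.r * a)
    τ z = let i , j , _ = R.onto (∈-allFin z) in combine i j
    στ : ∀ z → σ (τ z) ≡ z
    στ z with R.onto (∈-allFin z)
    ... | i , j , e = trans (cong (λ (i , j) → R.B i j) (remQuot-combine {R.r} i j)) e
    h : ∀ x y → adj G (σ x) (σ y) ≡ adj (CompleteMultipartite R.r a) x y
    h x y = trans (adj-σ x y) (sym (multipartite-adj R.r a x y))
      where
      adj-σ : ∀ x y → adj G (σ x) (σ y) ≡ not ⌊ quotient {R.r} a x ≟ quotient {R.r} a y ⌋
      adj-σ x y with quotient {R.r} a x ≟ quotient {R.r} a y
      ... | no ne = R.diff _ _ ne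
      ... | yes e with adj G (σ x) (σ y) in eq
      ... | false = refl
      ... | true = ⊥-elim (R.same _ _ _ (subst (λ i → Edge G (R.B i (remainder {R.r} a x)) (σ y)) e eq))
    σ-inj : ∀ {x y} → σ x ≡ σ y → x ≡ y
    σ-inj {x} {y} e with quotient {R.r} a x ≟ quotient {R.r} a y
    ... | no ne = ⊥-elim (edge-≢ G (R.diff (remainder {R.r} a x) (remainder {R.r} a y) ne) e)
    ... | yes q = trans (sym (combine-remQuot {R.r} a x)) (trans (cong₂ combine q
      (R.inj _ (trans (cong (λ i → R.B i (remainder {R.r} a x)) (sym q)) e))) (combine-remQuot {R.r} a y))

-- The trees T p q

≅⇒Embeds : ∀ {a b} (A : Graph a) (B : Graph b) → A ≅ B → Embeds A B
≅⇒Embeds A B (φ , h) = Inverse.to φ ,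
  (λ e → trans (sym (Inverse.strictlyInverseʳ φ _)) (trans (cong (Inverse.from φ) e) (Inverse.strictlyInverseʳ φ _))) ,
  λ x y e → trans (sym (h x y)) e

≅⇒Embeds⁻¹ : ∀ {a b} (A : Graph a) (B : Graph b) → A ≅ B → Embeds B A
≅⇒Embeds⁻¹ A B (φ , h) = Inverse.from φ ,
  (λ e → trans (sym (Inverse.strictlyInverseˡ φ _)) (trans (cong (Inverse.to φ) e) (Inverse.strictlyInverseˡ φ _))) ,
  λ x y e → trans (h _ _) (trans (cong₂ (adj B) (Inverse.strictlyInverseˡ φ x) (Inverse.strictlyInverseˡ φ y)) e)

Embeds-trans : ∀ {a b c} (A : Graph a) (B : Graph b) (C : Graph c) → Embeds A B → Embeds B C → Embeds A C
Embeds-trans A B C (f , fi , fh) (g , gi , gh) = g ∘ f , fi ∘ gi , λ x y e → gh _ _ (fh x y e)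

-- In the notation of the paper, centre is v₃, hub₁ is v₂ and hub₂ is v₄.
data Kind : Set where
  centre hub₁ hub₂ leaf₁ leaf₂ : Kind

-- Adjacency in `T p q` depends on the kinds only, so statements about all `p` and `q` reduce to a
-- five by five table.
link : Kind → Kind → Bool
link centre hub₁ = true
link centre hub₂ = true
link hub₁ centre = true
link hub₂ centre = true
link hub₁ leaf₁ = true
link leaf₁ hub₁ = true
link hub₂ leaf₂ = true
link leaf₂ hub₂ = true
link _ _ = false

leafKind : ℕ → ℕ → Kind
leafKind p i = if i <ᵇ p then leaf₁ else leaf₂

kind : ℕ → ℕ → Kind
kind p 0 = centre
kind p 1 = hub₁
kind p 2 = hub₂
kind p (suc (suc (suc i))) = leafKind p i

private
  -- Repeats the arc relation of T, which is private to its module.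
  arc : ℕ → ℕ → ℕ → Bool
  arc p i j =
       ((i ≡ᵇ 0) ∧ ((j ≡ᵇ 1) ∨ (j ≡ᵇ 2)))
    ∨ ((i ≡ᵇ 1) ∧ ((3 ≤ᵇ j) ∧ (j <ᵇ p + 3)))
    ∨ ((i ≡ᵇ 2) ∧ (p + 3 ≤ᵇ j))

  -- The test `3 + p ≤ᵇ 3 + i` for a leaf at the second hub computes to `p <ᵇ suc i`, whereas
  -- `leafKind` tests `i <ᵇ p`.
  <ᵇ-suc : ∀ p i → (p <ᵇ suc i) ≡ not (i <ᵇ p)
  <ᵇ-suc zero i = refl
  <ᵇ-suc (suc p) zero = refl
  <ᵇ-suc (suc p) (suc i) = <ᵇ-suc p i

  arc-link : ∀ p i j → arc p i j ∨ arc p j i ≡ link (kind p i) (kind p j)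
  arc-link p i j rewrite +-comm p 3 = go i j
    where
    go : ∀ i j → (((i ≡ᵇ 0) ∧ ((j ≡ᵇ 1) ∨ (j ≡ᵇ 2))) ∨ ((i ≡ᵇ 1) ∧ ((3 ≤ᵇ j) ∧ (j <ᵇ 3 + p))) ∨ ((i ≡ᵇ 2) ∧ (3 + p ≤ᵇ j)))
               ∨ (((j ≡ᵇ 0) ∧ ((i ≡ᵇ 1) ∨ (i ≡ᵇ 2))) ∨ ((j ≡ᵇ 1) ∧ ((3 ≤ᵇ i) ∧ (i <ᵇ 3 + p))) ∨ ((j ≡ᵇ 2) ∧ (3 + p ≤ᵇ i)))
               ≡ link (kind p i) (kind p j)
    go 0 0 = refl
    go 0 1 = refl
    go 0 2 = refl
    go 0 (suc (suc (suc j))) with j <ᵇ p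
    ... | true = refl
    ... | false = refl
    go 1 0 = refl
    go 1 1 = refl
    go 1 2 = refl
    go 1 (suc (suc (suc j))) with j <ᵇ p
    ... | true = refl
    ... | false = refl
    go 2 0 = refl
    go 2 1 = refl
    go 2 2 = refl
    go 2 (suc (suc (suc j))) rewrite <ᵇ-suc p j with j <ᵇ p
    ... | true = refl
    ... | false = refl
    go (suc (suc (suc i))) 0 with i <ᵇ p
    ... | true = refl
    ... | false = refl
    go (suc (suc (suc i))) 1 with i <ᵇ p
    ... | true = refl
    ... | false = refl
    go (suc (suc (suc i))) 2 rewrite <ᵇ-suc p i with i <ᵇ p
    ... | true = refl
    ... | false = refl
    go (suc (suc (suc i))) (suc (suc (suc j))) with i <ᵇ p | j <ᵇ p
    ... | true | true = refl
    ... | true | false = refl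
    ... | false | true = refl
    ... | false | false = refl

link-irrefl : ∀ k → link k k ≡ false
link-irrefl centre = refl
link-irrefl hub₁ = refl
link-irrefl hub₂ = refl
link-irrefl leaf₁ = refl
link-irrefl leaf₂ = refl

T-adj : ∀ p q i j → adj (T p q) i j ≡ link (kind p (toℕ i)) (kind p (toℕ j))
T-adj p q i j with i ≟ j
... | yes refl = sym (link-irrefl (kind p (toℕ i)))
... | no _ = arc-link p (toℕ i) (toℕ j)

-- With the 3 in front, the centre and the hubs are constructor terms on which `kind` computes.
relabel : ∀ p q {h} {H : Graph h} → Embeds (T p q) H → Σ (Fin (3 + (p + q)) → Fin h) λ Φ →
          (∀ i j → Φ i ≡ Φ j → i ≡ j) × (∀ i j → link (kind p (toℕ i)) (kind p (toℕ j)) ≡ true → Edge H (Φ i) (Φ j))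
relabel p q (φ , inj , hom) = φ ∘ cast eq , (λ i j e → cast-injective eq (inj e)) ,
  λ i j e → hom _ _ (trans (T-adj p q (cast eq i) (cast eq j))
    (trans (cong₂ (λ a b → link (kind p a) (kind p b)) (toℕ-cast eq i) (toℕ-cast eq j)) e))
  where
  eq : 3 + (p + q) ≡ p + q + 3
  eq = +-comm 3 (p + q)

-- The exceptional trees do not embed

multipartite-edge⁻ : ∀ r s {x y} → Edge (CompleteMultipartite r s) x y → quotient {r} s x ≢ quotient {r} s y
multipartite-edge⁻ r s {x} {y} e eq with quotient {r} s x ≟ quotient {r} s y | trans (sym (multipartite-adj r s x y)) e
... | yes _ | ()
... | no ne | _ = ne eq

-- Without part `κ` there remain `k` parts of size `s`, which `punchOut` renumbers.
outside-part : ∀ k s {N} (f : Fin N → Fin ((1 + k) * s)) → Injective _≡_ _≡_ f → ∀ κ →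
               (∀ j → κ ≢ quotient {1 + k} s (f j)) → N ≤ k * s
outside-part k s f inj κ ne = injective⇒≤ {f = λ j → combine (punchOut (ne j)) (remainder {1 + k} s (f j))} λ {i} {j} e →
  let e₁ , e₂ = combine-injective _ _ _ _ e in
  inj (trans (sym (combine-remQuot {1 + k} s (f i))) (trans (cong₂ combine (punchOut-injective (ne i) (ne j) e₁) e₂) (combine-remQuot {1 + k} s (f j))))

fin2 : ∀ {x y z : Fin 2} → x ≢ y → z ≢ y → x ≡ z
fin2 {zero} {_} {zero} _ _ = refl
fin2 {suc zero} {_} {suc zero} _ _ = refl
fin2 {zero} {zero} {suc zero} a _ = ⊥-elim (a refl)
fin2 {zero} {suc zero} {suc zero} _ b = ⊥-elim (b refl)
fin2 {suc zero} {zero} {zero} _ b = ⊥-elim (b refl)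
fin2 {suc zero} {suc zero} {zero} a _ = ⊥-elim (a refl)

-- Both hubs lie in the part opposite to the centre. The centre and all `p + q` leaves then share
-- the other part, which is one place too small.
¬T⊆bipartite : ∀ p q → ¬ Embeds (T p q) (CompleteBipartite (p + q))
¬T⊆bipartite p q emb with relabel p q {H = CompleteBipartite (p + q)} emb
... | Φ , inj , hom = 1+n≰n (subst (suc (p + q) ≤_) (*-identityˡ (p + q))
  (outside-part 1 (p + q) (Φ ∘ f) (λ {i} {j} e → f-inj i j (inj _ _ e)) (κ (suc zero)) far))
  where
  κ : Fin (3 + (p + q)) → Fin 2
  κ x = quotient {2} (p + q) (Φ x)
  κ-edge : ∀ x y → link (kind p (toℕ x)) (kind p (toℕ y)) ≡ true → κ x ≢ κ y
  κ-edge x y e = multipartite-edge⁻ 2 (p + q) (hom x y e)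
  hubs : κ (suc zero) ≡ κ (suc (suc zero))
  hubs = fin2 (κ-edge (suc zero) zero refl) (κ-edge (suc (suc zero)) zero refl)
  f : Fin (suc (p + q)) → Fin (3 + (p + q))
  f zero = zero
  f (suc j) = suc (suc (suc j))
  f-inj : ∀ i j → f i ≡ f j → i ≡ j
  f-inj zero zero _ = refl
  f-inj (suc i) (suc .i) refl = refl
  far : ∀ j → κ (suc zero) ≢ κ (f j)
  far zero = κ-edge (suc zero) zero refl
  far (suc j) with toℕ j <ᵇ p in eq
  ... | true = κ-edge (suc zero) (suc (suc (suc j))) (cong (λ b → link hub₁ (if b then leaf₁ else leaf₂)) eq)
  ... | false = subst (_≢ κ (f (suc j))) (sym hubs)
    (κ-edge (suc (suc zero)) (suc (suc (suc j))) (cong (λ b → link hub₂ (if b then leaf₁ else leaf₂)) eq))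

-- The d neighbours of the second hub fill all other parts, so neither place is left for the first hub and its leaf.
¬T⊆multipartite : ∀ k a q → k * a ≤ suc q → ¬ Embeds (T 1 q) (CompleteMultipartite (1 + k) a)
¬T⊆multipartite k a q le emb with relabel 1 q {H = CompleteMultipartite (1 + k) a} emb
... | Φ , inj , hom = 1+n≰n (≤-trans
  (outside-part k a (Φ ∘ f) (λ {i} {j} e → f-inj i j (inj _ _ e)) (κ hub) far) le)
  where
  κ : Fin (4 + q) → Fin (1 + k)
  κ x = quotient {1 + k} a (Φ x)
  κ-edge : ∀ x y → link (kind 1 (toℕ x)) (kind 1 (toℕ y)) ≡ true → κ x ≢ κ y
  κ-edge x y e = multipartite-edge⁻ (1 + k) a (hom x y e)
  hub : Fin (4 + q)
  hub = suc (suc zero)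
  -- Either the first hub is outside the part of the second one, or it is inside and its leaf is
  -- outside. With the `q + 1` neighbours of the second hub this makes `q + 2` vertices outside that
  -- part.
  spare : Σ (Fin (4 + q)) λ s → κ hub ≢ κ s × s ≢ zero × (∀ j → s ≢ suc (suc (suc (suc j))))
  spare with κ (suc zero) ≟ κ hub
  ... | yes e = suc (suc (suc zero)) ,
    (λ e′ → κ-edge (suc zero) (suc (suc (suc zero))) refl (trans e e′)) , (λ ()) , λ _ ()
  ... | no ne = suc zero , ne ∘ sym , (λ ()) , λ _ ()
  f : Fin (2 + q) → Fin (4 + q)
  f zero = zero
  f (suc zero) = proj₁ spare
  f (suc (suc j)) = suc (suc (suc (suc j)))
  f-inj : ∀ i j → f i ≡ f j → i ≡ j
  f-inj zero zero _ = refl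
  f-inj zero (suc zero) e = ⊥-elim (proj₁ (proj₂ (proj₂ spare)) (sym e))
  f-inj (suc zero) zero e = ⊥-elim (proj₁ (proj₂ (proj₂ spare)) e)
  f-inj (suc zero) (suc zero) _ = refl
  f-inj (suc zero) (suc (suc j)) e = ⊥-elim (proj₂ (proj₂ (proj₂ spare)) j e)
  f-inj (suc (suc i)) (suc zero) e = ⊥-elim (proj₂ (proj₂ (proj₂ spare)) i (sym e))
  f-inj (suc (suc i)) (suc (suc .i)) refl = refl
  far : ∀ j → κ hub ≢ κ (f j)
  far zero = κ-edge hub zero refl
  far (suc zero) = proj₁ (proj₂ spare)
  far (suc (suc j)) = κ-edge hub (suc (suc (suc (suc j)))) refl

-- Recognising `T p q`

module Broom {n : ℕ} (F : Graph n) (connected : Connected F) {c u w : Fin n} (u≢w : u ≢ w) (cu : Edge F c u) (cw : Edge F c w)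
         (nbrs-c : ∀ z → Edge F c z → z ≡ u ⊎ z ≡ w)
         (leaves-u : ∀ z → Edge F u z → z ≢ c → Leaf F z u) (leaves-w : ∀ z → Edge F w z → z ≢ c → Leaf F z w) where

  others : Fin n → List (Fin n)
  others h = filter (¬? ∘ (_≟ c)) (nbrs F h)

  ∈others⁺ : ∀ {h z} → Edge F h z → z ≢ c → z ∈ others h
  ∈others⁺ e ne = ∈-filter⁺ (¬? ∘ (_≟ c)) (∈nbrs⁺ F e) ne

  ∈others⁻ : ∀ {h z} → z ∈ others h → Edge F h z × z ≢ c
  ∈others⁻ {h} z∈ with ∈-filter⁻ (¬? ∘ (_≟ c)) {xs = nbrs F h} z∈
  ... | a , b = ∈nbrs⁻ F a , b

  others-unique : ∀ h → Unique (others h)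
  others-unique h = Uniq.filter⁺ (¬? ∘ (_≟ c)) (nbrs-unique F h)

  private
    -- Follows the numbering of `T`, so that positions in the list are the vertices of `T`.
    order : List (Fin n)
    order = c ∷ u ∷ w ∷ (others u ++ others w)

    data Class : Fin n → Kind → Set where
      is-centre : Class c centre
      is-hub₁ : Class u hub₁
      is-hub₂ : Class w hub₂
      is-leaf₁ : ∀ {z} → z ≢ c → Leaf F z u → Class z leaf₁
      is-leaf₂ : ∀ {z} → z ≢ c → Leaf F z w → Class z leaf₂

    absent : ∀ {x y} → ¬ Edge F x y → adj F x y ≡ false
    absent {x} {y} ne with adj F x y
    ... | true = ⊥-elim (ne refl)
    ... | false = refl

    u≁w : ¬ Edge F u w
    u≁w e = edge-≢ F cu (proj₂ (leaves-u w e (edge-≢ F (edge-sym F cw))) c (edge-sym F cw))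

    c≁leaf : ∀ {z h} → c ≢ h → Leaf F z h → ¬ Edge F c z
    c≁leaf c≢h (_ , only) e = c≢h (only c (edge-sym F e))

    leaf≁ : ∀ {z h t} → Leaf F z h → t ≢ h → ¬ Edge F z t
    leaf≁ (_ , only) t≢h e = t≢h (only _ e)

    class-adj : ∀ {x y k k′} → Class x k → Class y k′ → adj F x y ≡ link k k′
    class-adj is-centre is-centre = adj-irrefl F c
    class-adj is-centre is-hub₁ = cu
    class-adj is-centre is-hub₂ = cw
    class-adj is-centre (is-leaf₁ _ l) = absent (c≁leaf (edge-≢ F cu) l)
    class-adj is-centre (is-leaf₂ _ l) = absent (c≁leaf (edge-≢ F cw) l)
    class-adj is-hub₁ is-centre = edge-sym F cu
    class-adj is-hub₁ is-hub₁ = adj-irrefl F u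
    class-adj is-hub₁ is-hub₂ = absent u≁w
    class-adj is-hub₁ (is-leaf₁ _ l) = edge-sym F (proj₁ l)
    class-adj is-hub₁ (is-leaf₂ _ l) = absent (leaf≁ l u≢w ∘ edge-sym F)
    class-adj is-hub₂ is-centre = edge-sym F cw
    class-adj is-hub₂ is-hub₁ = absent (u≁w ∘ edge-sym F)
    class-adj is-hub₂ is-hub₂ = adj-irrefl F w
    class-adj is-hub₂ (is-leaf₁ _ l) = absent (leaf≁ l (u≢w ∘ sym) ∘ edge-sym F)
    class-adj is-hub₂ (is-leaf₂ _ l) = edge-sym F (proj₁ l)
    class-adj (is-leaf₁ _ l) is-centre = absent (leaf≁ l (edge-≢ F cu))
    class-adj (is-leaf₁ _ l) is-hub₁ = proj₁ l
    class-adj (is-leaf₁ _ l) is-hub₂ = absent (leaf≁ l (u≢w ∘ sym))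
    class-adj (is-leaf₁ _ l) (is-leaf₁ _ l′) = absent λ e → edge-irrefl F (subst (Edge F _) (sym (proj₂ l _ e)) (proj₁ l′) )
    class-adj (is-leaf₁ _ l) (is-leaf₂ y≢c l′) = absent λ e → u≁w (subst (λ v → Edge F v w) (proj₂ l _ e) (proj₁ l′))
    class-adj (is-leaf₂ _ l) is-centre = absent (leaf≁ l (edge-≢ F cw))
    class-adj (is-leaf₂ _ l) is-hub₁ = absent (leaf≁ l u≢w)
    class-adj (is-leaf₂ _ l) is-hub₂ = proj₁ l
    class-adj (is-leaf₂ _ l) (is-leaf₁ _ l′) = absent λ e → u≁w (edge-sym F (subst (λ v → Edge F v u) (proj₂ l _ e) (proj₁ l′)))
    class-adj (is-leaf₂ _ l) (is-leaf₂ _ l′) = absent λ e → edge-irrefl F (subst (Edge F _) (sym (proj₂ l _ e)) (proj₁ l′))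

    class-leaves : ∀ {xs ys} → All (λ z → Class z leaf₁) xs → All (λ z → Class z leaf₂) ys →
                   ∀ i → Class (lookup (xs ++ ys) i) (leafKind (length xs) (toℕ i))
    class-leaves [] ys i = All.lookup ys (∈-lookup i)
    class-leaves (x ∷ xs) ys zero = x
    class-leaves (x ∷ xs) ys (suc i) = class-leaves xs ys i

    class : ∀ i → Class (lookup order i) (kind (length (others u)) (toℕ i))
    class zero = is-centre
    class (suc zero) = is-hub₁
    class (suc (suc zero)) = is-hub₂
    class (suc (suc (suc i))) = class-leaves
      (All.tabulate λ z∈ → let e , ne = ∈others⁻ z∈ in is-leaf₁ ne (leaves-u _ e ne))
      (All.tabulate λ z∈ → let e , ne = ∈others⁻ z∈ in is-leaf₂ ne (leaves-w _ e ne)) i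

    order-unique : Unique order
    order-unique = cons-unique c∉ (cons-unique u∉ (cons-unique w∉ (Uniq.++⁺ (others-unique u) (others-unique w) disjoint)))
      where
      disjoint : ∀ {z} → z ∈ others u × z ∈ others w → ⊥
      disjoint (a , b) with ∈others⁻ a | ∈others⁻ b
      ... | ua , ne | wa , _ = u≢w (sym (proj₂ (leaves-u _ ua ne) w (edge-sym F wa)))
      c∉ : c ∉ u ∷ w ∷ (others u ++ others w)
      c∉ (here e) = edge-≢ F cu e
      c∉ (there (here e)) = edge-≢ F cw e
      c∉ (there (there z∈)) = [ (λ z∈ → proj₂ (∈others⁻ {u} z∈) refl) , (λ z∈ → proj₂ (∈others⁻ {w} z∈) refl) ]′ (∈-++⁻ (others u) z∈)
      u∉ : u ∉ w ∷ (others u ++ others w)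
      u∉ (here e) = u≢w e
      u∉ (there z∈) = [ (λ z∈ → edge-irrefl F (proj₁ (∈others⁻ z∈))) , (λ z∈ → u≁w (edge-sym F (proj₁ (∈others⁻ z∈)))) ]′ (∈-++⁻ (others u) z∈)
      w∉ : w ∉ others u ++ others w
      w∉ z∈ = [ (λ z∈ → u≁w (proj₁ (∈others⁻ z∈))) , (λ z∈ → edge-irrefl F (proj₁ (∈others⁻ z∈))) ]′ (∈-++⁻ (others u) z∈)

    in-u : ∀ {z} → Edge F u z → z ∈ order
    in-u {z} e with z ≟ c
    ... | yes refl = here refl
    ... | no ne = there (there (there (∈-++⁺ˡ (∈others⁺ e ne))))

    in-w : ∀ {z} → Edge F w z → z ∈ order
    in-w {z} e with z ≟ c
    ... | yes refl = here refl
    ... | no ne = there (there (there (∈-++⁺ʳ (others u) (∈others⁺ e ne))))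

    order-closed : ∀ {s t} → s ∈ order → Edge F s t → t ∈ order
    order-closed (here refl) e with nbrs-c _ e
    ... | inj₁ refl = there (here refl)
    ... | inj₂ refl = there (there (here refl))
    order-closed (there (here refl)) e = in-u e
    order-closed (there (there (here refl))) e = in-w e
    order-closed (there (there (there s∈))) e with ∈-++⁻ (others u) s∈
    ... | inj₁ s∈u with ∈others⁻ s∈u
    ... | us , ne = subst (_∈ order) (sym (proj₂ (leaves-u _ us ne) _ e)) (there (here refl))
    order-closed (there (there (there s∈))) e | inj₂ s∈w with ∈others⁻ s∈w
    ... | ws , ne = subst (_∈ order) (sym (proj₂ (leaves-w _ ws ne) _ e)) (there (there (here refl)))

    covers : ∀ z → z ∈ order
    covers z = closed F {_∈ order} order-closed (connected c z) (here refl)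

    order-length : length (others u) + length (others w) + 3 ≡ length order
    order-length = trans (+-comm _ 3) (cong (3 +_) (sym (length-++ (others u))))

  broom-size : length (others u) + length (others w) + 3 ≡ n
  broom-size = trans order-length (≤-antisym (unique-length≤ order-unique) (subst (_≤ length order) (length-allFin n)
    (unique-⊆-length (Uniq.allFin⁺ n) λ {z} _ → covers z)))

  broom : F ≅ T (length (others u)) (length (others w))
  broom = ≅-from F (T (length (others u)) (length (others w)))
    (lookup order ∘ cast order-length) (λ z → cast (sym order-length) (index (covers z)))
    (λ {i} {j} e → cast-injective order-length (lookup-injective order-unique _ _ e))
    (λ z → trans (cong (lookup order) (cast-cast order-length (sym order-length) _)) (sym (lookup-index (covers z))))
    λ i j → trans (class-adj (class (cast order-length i)) (class (cast order-length j)))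
      (trans (cong₂ (λ a b → link (kind (length (others u)) a) (kind (length (others u)) b)) (toℕ-cast order-length i) (toℕ-cast order-length j))
        (sym (T-adj (length (others u)) (length (others w)) i j)))

-- Extending small pieces of the tree

∉-[] : ∀ {A : Set} {x : A} → x ∉ []
∉-[] ()

infixr 5 _∉∷_
_∉∷_ : ∀ {A : Set} {x y : A} {l} → x ≢ y → x ∉ l → x ∉ y ∷ l
(ne ∉∷ _) (here e) = ne e
(_ ∉∷ x∉) (there x∈) = x∉ x∈

not-leaf : ∀ {n} {F : Graph n} {z h t s} → Leaf F z h → Edge F t s → s ≢ h → t ≢ z
not-leaf (_ , only) e s≢h refl = s≢h (only _ e)

module _ {d m : ℕ} {F : Graph (3 + d)} {G : Graph m}
         (acyclic : ¬ HasCycle F) (conF : Connected F) (conG : Connected G)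
         (large : 3 + d ≤ m) (δ : ∀ v → d ≤ deg G v) where

  module Extension {x y u hx hy : Fin (3 + d)} (x≢y : x ≢ y) (leaf-x : Leaf F x hx) (leaf-y : Leaf F y hy)
                   (cmp : Completable F G x y u) (Ku : Kept F G x y u) where

    K : Fin (3 + d) → Set
    K = Kept F G x y

    private
      x∉ : ∀ {t l} → K t → x ∉ l → x ∉ t ∷ l
      x∉ (a , _) = (a ∘ sym) ∉∷_
      y∉ : ∀ {t l} → K t → y ∉ l → y ∉ t ∷ l
      y∉ (_ , b) = (b ∘ sym) ∉∷_

      spread′ : ∀ {L v} (N : List (Fin m)) → Partial F G L → (u , v) ∈ L → x ∉ dom F G L → y ∉ dom F G L → Unique N →
                (∀ {b} → b ∈ N → b ∈ ran F G L × b ≢ v × ¬ Edge G v b) → 2 + d ≤ length N + deg G v → ⊥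
      spread′ = spread acyclic conF δ x≢y leaf-x leaf-y cmp

      kept-length : ∀ {l} → Unique l → All K l → 2 + length l ≤ 3 + d
      kept-length {l} uq ks = unique-length≤ (cons-unique (x≢y ∉∷ λ x∈ → proj₁ (All.lookup ks x∈) refl)
        (cons-unique (λ y∈ → proj₂ (All.lookup ks y∈) refl) uq))

      far-≢ : ∀ {v a b : Fin m} → Edge G v a → ¬ Edge G v b → b ≢ a
      far-≢ va nb refl = nb va

    module _ {p p₁} (up : Edge F u p) (pp₁ : Edge F p p₁) (p₁≢u : p₁ ≢ u) (Kp : K p) (Kp₁ : K p₁) where

      -- For degree at least `d + 2` the single vertex `u` is enough. For degree `d + 1` one far
      -- vertex is needed, and `u`, `p`, `p₁` laid on an induced path reach it.
      regular : ∀ v → deg G v ≡ d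
      regular v = ≤-antisym (≮⇒≥ deg≯d) (δ v)
        where
        deg≯d : ¬ (d < deg G v)
        deg≯d d<deg with 2 + d ≤? deg G v
        ... | yes le = spread′ [] (start u v) (here refl) (x∉ Ku ∉-[]) (y∉ Ku ∉-[]) [] (λ ()) le
        ... | no ≰ with induced-path G conG v (≤-trans (s≤s (≰⇒> ≰)) large)
        ... | a , b , va , ab , b≢v , v≁b = spread′ (b ∷ [])
          (grow (edge-≢ F (edge-sym F pp₁) ∉∷ p₁≢u ∉∷ ∉-[]) (edge-≢ G (edge-sym G ab) ∉∷ b≢v ∉∷ ∉-[]) (here refl) pp₁ ab
            (grow (edge-≢ F (edge-sym F up) ∉∷ ∉-[]) (edge-≢ G (edge-sym G va) ∉∷ ∉-[]) (here refl) up va (start u v)))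
          (there (there (here refl))) (x∉ Kp₁ (x∉ Kp (x∉ Ku ∉-[]))) (y∉ Kp₁ (y∉ Kp (y∉ Ku ∉-[]))) ([] ∷ [])
          (λ { (here refl) → here refl , b≢v , v≁b }) (s≤s d<deg)

      -- If `p` had a third neighbour, the star at `p` could be laid on a vertex with two neighbours
      -- far from `v`; `fork` supplies such a place.
      no-fork : ∀ {p₂} → Edge F p p₂ → p₂ ≢ u → p₂ ≢ p₁ → K p₂ → ⊥
      no-fork {p₂} pp₂ p₂≢u p₂≢p₁ Kp₂ = fork G conG regular 3≤d large λ {v} {a} {b} {b′} va ab ab′ b≢b′ (b≢v , v≁b) (b′≢v , v≁b′) →
        spread′ (b ∷ b′ ∷ [])
          (grow (p₂≢p₁ ∉∷ edge-≢ F (edge-sym F pp₂) ∉∷ p₂≢u ∉∷ ∉-[]) ((b≢b′ ∘ sym) ∉∷ far-≢ va v≁b′ ∉∷ b′≢v ∉∷ ∉-[]) (there (here refl)) pp₂ ab′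
            (grow (edge-≢ F (edge-sym F pp₁) ∉∷ p₁≢u ∉∷ ∉-[]) (far-≢ va v≁b ∉∷ b≢v ∉∷ ∉-[]) (here refl) pp₁ ab
              (grow (edge-≢ F (edge-sym F up) ∉∷ ∉-[]) (edge-≢ G (edge-sym G va) ∉∷ ∉-[]) (here refl) up va (start u v))))
          (there (there (there (here refl)))) (x∉ Kp₂ (x∉ Kp₁ (x∉ Kp (x∉ Ku ∉-[])))) (y∉ Kp₂ (y∉ Kp₁ (y∉ Kp (y∉ Ku ∉-[]))))
          (cons-unique (b≢b′ ∉∷ ∉-[]) ([] ∷ []))
          (λ { (here refl) → there (here refl) , b≢v , v≁b ; (there (here refl)) → here refl , b′≢v , v≁b′ }) (s≤s (s≤s (δ v)))
        where
        -- The four vertices of the star together with `x` and `y` give `6 ≤ 3 + d`.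
        3≤d : 3 ≤ d
        3≤d = ≤-pred (≤-pred (≤-pred (kept-length {p₂ ∷ p₁ ∷ p ∷ u ∷ []}
          (cons-unique (p₂≢p₁ ∉∷ edge-≢ F (edge-sym F pp₂) ∉∷ p₂≢u ∉∷ ∉-[])
            (cons-unique (edge-≢ F (edge-sym F pp₁) ∉∷ p₁≢u ∉∷ ∉-[]) (cons-unique (edge-≢ F (edge-sym F up) ∉∷ ∉-[]) ([] ∷ []))))
          (Kp₂ ∷ Kp₁ ∷ Kp ∷ Ku ∷ []))))

      only-two : (∀ {t} → Edge F p t → t ≢ u → K t) → ∀ t → Edge F p t → t ≡ u ⊎ t ≡ p₁
      only-two kept t pt with t ≟ u | t ≟ p₁
      ... | yes e | _ = inj₁ e
      ... | no _ | yes e = inj₂ e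
      ... | no t≢u | no t≢p₁ = ⊥-elim (no-fork pt t≢u t≢p₁ (kept pt t≢u))

      module _ {p₂} (p₁p₂ : Edge F p₁ p₂) (p₂≢p : p₂ ≢ p) (p₂≢u : p₂ ≢ u) (Kp₂ : K p₂) where

        Twin : Set
        Twin = ∀ {v z} → ¬ Edge G v z → ∀ {c} → Edge G z c → Edge G v c

        twin : Twin
        twin = twins G conG λ {v} {a} {b} {c} va ab bc (b≢v , v≁b) (c≢v , v≁c) →
          spread′ (b ∷ c ∷ [])
            (grow (edge-≢ F (edge-sym F p₁p₂) ∉∷ p₂≢p ∉∷ p₂≢u ∉∷ ∉-[]) (edge-≢ G (edge-sym G bc) ∉∷ far-≢ va v≁c ∉∷ c≢v ∉∷ ∉-[]) (here refl) p₁p₂ bc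
              (grow (edge-≢ F (edge-sym F pp₁) ∉∷ p₁≢u ∉∷ ∉-[]) (far-≢ va v≁b ∉∷ b≢v ∉∷ ∉-[]) (here refl) pp₁ ab
                (grow (edge-≢ F (edge-sym F up) ∉∷ ∉-[]) (edge-≢ G (edge-sym G va) ∉∷ ∉-[]) (here refl) up va (start u v))))
            (there (there (there (here refl)))) (x∉ Kp₂ (x∉ Kp₁ (x∉ Kp (x∉ Ku ∉-[])))) (y∉ Kp₂ (y∉ Kp₁ (y∉ Kp (y∉ Ku ∉-[]))))
            (cons-unique (edge-≢ G bc ∉∷ ∉-[]) ([] ∷ []))
            (λ { (here refl) → there (here refl) , b≢v , v≁b ; (there (here refl)) → here refl , c≢v , v≁c }) (s≤s (s≤s (δ v)))

        -- By regularity a part has `m ∸ d` vertices, at least three, of which `v` is one.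
        two-far : ∀ v → ∃₂ λ b b′ → b ≢ b′ × Far G v b × Far G v b′
        two-far v with fresh (v ∷ []) (part-unique G twin v) (≤-trans (n≤1+n 2) three) | three
          where
          three : 3 ≤ length (part G twin v)
          three = +-cancelʳ-≤ d 3 _ (subst (3 + d ≤_) (sym (trans (cong (length (part G twin v) +_) (sym (regular v))) (length-part G twin v))) large)
        ... | b , b∈ , b∉ | three with fresh (b ∷ v ∷ []) (part-unique G twin v) three
        ... | b′ , b′∈ , b′∉ = b , b′ , (λ e → b′∉ (here (sym e))) ,
          (b∉ ∘ here , ∈part⁻ G twin b∈) , (b′∉ ∘ there ∘ here , ∈part⁻ G twin b′∈)

        private
          twin-edge : ∀ {v b a} → Far G v b → Edge G v a → Edge G a b
          twin-edge (_ , v≁b) va = edge-sym G (twin (v≁b ∘ edge-sym G) va)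

          2≤d : 2 ≤ d
          2≤d = ≤-trans (n≤1+n 2) (≤-pred (≤-pred (≤-pred (kept-length {p₂ ∷ p₁ ∷ p ∷ u ∷ []}
            (cons-unique (edge-≢ F (edge-sym F p₁p₂) ∉∷ p₂≢p ∉∷ p₂≢u ∉∷ ∉-[])
              (cons-unique (edge-≢ F (edge-sym F pp₁) ∉∷ p₁≢u ∉∷ ∉-[]) (cons-unique (edge-≢ F (edge-sym F up) ∉∷ ∉-[]) ([] ∷ []))))
            (Kp₂ ∷ Kp₁ ∷ Kp ∷ Ku ∷ [])))))

        -- By the twin property a path can alternate between the part of `v` and its neighbours; on
        -- `v`, `a`, `b`, `a′`, `b′` it meets two far vertices.
        no-path : Fin m → ∀ {p₃} → Edge F p₂ p₃ → p₃ ∉ p₂ ∷ p₁ ∷ p ∷ u ∷ [] → K p₃ → ⊥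
        no-path v {p₃} p₂p₃ p₃∉ Kp₃ = place (two-far v) (two-nbrs G (≤-trans 2≤d (δ v)))
          where
          place : (∃₂ λ b b′ → b ≢ b′ × Far G v b × Far G v b′) → (∃₂ λ a a′ → a ≢ a′ × Edge G v a × Edge G v a′) → ⊥
          place (b , b′ , b≢b′ , fb , fb′) (a , a′ , a≢a′ , va , va′) = spread′ (b ∷ b′ ∷ []) P₃
            (there (there (there (there (here refl))))) (x∉ Kp₃ (x∉ Kp₂ (x∉ Kp₁ (x∉ Kp (x∉ Ku ∉-[]))))) (y∉ Kp₃ (y∉ Kp₂ (y∉ Kp₁ (y∉ Kp (y∉ Ku ∉-[])))))
            (cons-unique (b≢b′ ∉∷ ∉-[]) ([] ∷ []))
            (λ { (here refl) → there (there (here refl)) , fb ; (there (here refl)) → here refl , fb′ }) (s≤s (s≤s (δ v)))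
            where
            ab : Edge G a b
            ab = twin-edge fb va
            a′b : Edge G a′ b
            a′b = twin-edge fb va′
            a′b′ : Edge G a′ b′
            a′b′ = twin-edge fb′ va′
            P₁ : Partial F G ((p₁ , b) ∷ (p , a) ∷ (u , v) ∷ [])
            P₁ = grow (edge-≢ F (edge-sym F pp₁) ∉∷ p₁≢u ∉∷ ∉-[]) (far-≢ va (proj₂ fb) ∉∷ proj₁ fb ∉∷ ∉-[]) (here refl) pp₁ ab
              (grow (edge-≢ F (edge-sym F up) ∉∷ ∉-[]) (edge-≢ G (edge-sym G va) ∉∷ ∉-[]) (here refl) up va (start u v))
            P₂ : Partial F G ((p₂ , a′) ∷ (p₁ , b) ∷ (p , a) ∷ (u , v) ∷ [])
            P₂ = grow (edge-≢ F (edge-sym F p₁p₂) ∉∷ p₂≢p ∉∷ p₂≢u ∉∷ ∉-[])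
              (edge-≢ G a′b ∉∷ (a≢a′ ∘ sym) ∉∷ edge-≢ G (edge-sym G va′) ∉∷ ∉-[]) (here refl) p₁p₂ (edge-sym G a′b) P₁
            P₃ : Partial F G ((p₃ , b′) ∷ (p₂ , a′) ∷ (p₁ , b) ∷ (p , a) ∷ (u , v) ∷ [])
            P₃ = grow p₃∉ (edge-≢ G (edge-sym G a′b′) ∉∷ (b≢b′ ∘ sym) ∉∷ far-≢ va (proj₂ fb′) ∉∷ proj₁ fb′ ∉∷ ∉-[]) (here refl) p₂p₃ a′b′ P₂

        -- A triangle allows `p₁` to sit on a neighbour `c` of `v`. By the twin property `c` is
        -- adjacent to the whole part of `v`, so both further neighbours of `p₁` can go to far
        -- vertices.
        no-broom : ∀ {v a c} → Edge G v a → Edge G v c → Edge G a c →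
                   ∀ {p₃} → Edge F p₁ p₃ → p₃ ∉ p₂ ∷ p₁ ∷ p ∷ u ∷ [] → K p₃ → ⊥
        no-broom {v} va vc ac p₁p₃ p₃∉ Kp₃ with two-far v
        ... | b , b′ , b≢b′ , fb , fb′ = spread′ (b ∷ b′ ∷ [])
          (grow p₃∉ ((b≢b′ ∘ sym) ∉∷ far-≢ vc (proj₂ fb′) ∉∷ far-≢ va (proj₂ fb′) ∉∷ proj₁ fb′ ∉∷ ∉-[]) (there (here refl)) p₁p₃ (twin-edge fb′ vc)
            (grow (edge-≢ F (edge-sym F p₁p₂) ∉∷ p₂≢p ∉∷ p₂≢u ∉∷ ∉-[])
                (far-≢ vc (proj₂ fb) ∉∷ far-≢ va (proj₂ fb) ∉∷ proj₁ fb ∉∷ ∉-[]) (here refl) p₁p₂ (twin-edge fb vc)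
              (grow (edge-≢ F (edge-sym F pp₁) ∉∷ p₁≢u ∉∷ ∉-[]) (edge-≢ G (edge-sym G ac) ∉∷ edge-≢ G (edge-sym G vc) ∉∷ ∉-[]) (here refl) pp₁ ac
                (grow (edge-≢ F (edge-sym F up) ∉∷ ∉-[]) (edge-≢ G (edge-sym G va) ∉∷ ∉-[]) (here refl) up va (start u v)))))
          (there (there (there (there (here refl))))) (x∉ Kp₃ (x∉ Kp₂ (x∉ Kp₁ (x∉ Kp (x∉ Ku ∉-[]))))) (y∉ Kp₃ (y∉ Kp₂ (y∉ Kp₁ (y∉ Kp (y∉ Ku ∉-[])))))
          (cons-unique (b≢b′ ∉∷ ∉-[]) ([] ∷ []))
          (λ { (here refl) → there (here refl) , fb ; (there (here refl)) → here refl , fb′ }) (s≤s (s≤s (δ v)))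

-- Total embeddings and the two short paths

partial-embeds : ∀ {n m} {F : Graph n} {G : Graph m} → ¬ HasCycle F → ∀ {L} → Partial F G L → (∀ t → t ∈ dom F G L) → Embeds F G
partial-embeds {F = F} {G} acyclic {L} P total = toFun F G P ,
  (λ {s} {t} e → injective F G P (at s) (subst (λ b → (t , b) ∈ L) (sym e) (at t))) ,
  λ s t → homomorphic F G acyclic P (at s) (at t)
  where
  at : ∀ t → (t , toFun F G P t) ∈ L
  at t = toFun-∈ F G P (total t)

multipartite-edge⁺ : ∀ r s {i i′ : Fin r} (j j′ : Fin s) → i ≢ i′ → Edge (CompleteMultipartite r s) (combine i j) (combine i′ j′)
multipartite-edge⁺ r s {i} {i′} j j′ ne = trans (multipartite-adj r s (combine i j) (combine i′ j′))
  (trans (cong₂ (λ a b → not (isYes (a ≟ b))) (cong proj₁ (remQuot-combine i j)) (cong proj₁ (remQuot-combine i′ j′))) (distinct ne))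
  where
  distinct : ∀ {i i′ : Fin r} → i ≢ i′ → not (isYes (i ≟ i′)) ≡ true
  distinct {i} {i′} ne with i ≟ i′
  ... | yes e = ⊥-elim (ne e)
  ... | no _ = refl

≅-order : ∀ {a b} (A : Graph a) (B : Graph b) → A ≅ B → a ≡ b
≅-order A B iso = ≤-antisym (injective⇒≤ (proj₁ (proj₂ (≅⇒Embeds A B iso)))) (injective⇒≤ (proj₁ (proj₂ (≅⇒Embeds⁻¹ A B iso))))

far-≢ : ∀ {m} {G : Graph m} {v a b} → Edge G v a → ¬ Edge G v b → b ≢ a
far-≢ va nb refl = nb va

-- An induced path v - a - b extends at both ends unless it lies on a 4-cycle, which would be all of G.
path₅ : ∀ {n m} {F : Graph n} {G : Graph m} → ¬ HasCycle F → Connected G → 5 ≤ m → (∀ v → deg G v ≡ 2) → Fin m →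
        ∀ {x u p w y} → Edge F x u → Edge F u p → Edge F p w → Edge F w y →
        Unique (y ∷ w ∷ p ∷ u ∷ x ∷ []) → (∀ t → t ∈ y ∷ w ∷ p ∷ u ∷ x ∷ []) → ¬ ¬ Embeds F G
path₅ {F = F} {G} acyclic conG 5≤m reg v {x} {u} {p} {w} {y} xu up pw wy uq total ne
  with induced-path G conG v (subst (λ k → suc k < _) (sym (reg v)) (≤-trans (n≤1+n 4) 5≤m))
... | a , b , va , ab , b≢v , v≁b = result
  (other {v} va) (other {b} (edge-sym G ab))
  where
  nbrs₂ : ∀ {s} → length (nbrs G s) ≡ 2
  nbrs₂ {s} = trans (length-nbrs G s) (reg s)
  other : ∀ {s t} → Edge G s t → ∃ λ c → Edge G s c × c ≢ t
  other {s} {t} st with fresh (t ∷ []) (nbrs-unique G s) (≤-reflexive (sym nbrs₂))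
  ... | c , c∈ , c∉ = c , ∈nbrs⁻ G c∈ , c∉ ∘ here
  only : ∀ {s t c} → Edge G s t → Edge G s c → c ≢ t → ∀ {z} → Edge G s z → z ∈ t ∷ c ∷ []
  only st sc c≢t sz = unique-⊆-full (cons-unique ((c≢t ∘ sym) ∉∷ ∉-[]) ([] ∷ []))
    (λ { (here refl) → ∈nbrs⁺ G st ; (there (here refl)) → ∈nbrs⁺ G sc }) (≤-reflexive nbrs₂) (∈nbrs⁺ G sz)
  result : (∃ λ c → Edge G v c × c ≢ a) → (∃ λ c → Edge G b c × c ≢ a) → ⊥
  result (c , vc , c≢a) (c′ , bc′ , c′≢a) with c ≟ c′
  ... | yes refl = 1+n≰n (≤-trans 5≤m (closed-length G conG (v ∷ a ∷ b ∷ c ∷ []) (here refl) cl))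
    where
    cl : ∀ {s t} → s ∈ v ∷ a ∷ b ∷ c ∷ [] → Edge G s t → t ∈ v ∷ a ∷ b ∷ c ∷ []
    cl (here refl) e with only va vc c≢a e
    ... | here z = there (here z)
    ... | there (here z) = there (there (there (here z)))
    cl (there (here refl)) e with only (edge-sym G va) ab b≢v e
    ... | here z = here z
    ... | there (here z) = there (there (here z))
    cl (there (there (here refl))) e with only (edge-sym G ab) bc′ c≢a e
    ... | here z = there (here z)
    ... | there (here z) = there (there (there (here z)))
    cl (there (there (there (here refl)))) e with only (edge-sym G vc) (edge-sym G bc′) b≢v e
    ... | here z = here z
    ... | there (here z) = there (there (here z))
  ... | no c≢c′ with uncons-unique uq
  ... | y∉ , uq₁ with uncons-unique uq₁
  ... | w∉ , uq₂ with uncons-unique uq₂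
  ... | p∉ , uq₃ with uncons-unique uq₃
  ... | u∉ , _ = ne (partial-embeds {F = F} {G} acyclic
    (grow y∉ (edge-≢ G (edge-sym G bc′) ∉∷ c′≢a ∉∷ (λ { refl → v≁b (edge-sym G bc′) }) ∉∷ (c≢c′ ∘ sym) ∉∷ ∉-[]) (here refl) wy bc′
    (grow w∉ (edge-≢ G (edge-sym G ab) ∉∷ b≢v ∉∷ far-≢ {G = G} vc v≁b ∉∷ ∉-[]) (here refl) pw ab
    (grow p∉ (edge-≢ G (edge-sym G va) ∉∷ (c≢a ∘ sym) ∉∷ ∉-[]) (here refl) up va
    (grow u∉ (edge-≢ G vc ∉∷ ∉-[]) (here refl) xu (edge-sym G vc) (start x c))))) total)

-- Three neighbours of `v` and the three vertices `v`, `b`, `b′` of its part are completely joined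
-- to each other; the path alternates between the two triples.
path₆ : ∀ {n m} {F : Graph n} {G : Graph m} → ¬ HasCycle F → (∀ v → deg G v ≡ 3) →
        (∀ {v z} → ¬ Edge G v z → ∀ {c} → Edge G z c → Edge G v c) →
        (v : Fin m) → (∃₂ λ b b′ → b ≢ b′ × Far G v b × Far G v b′) →
        ∀ {x u p q w y} → Edge F x u → Edge F u p → Edge F p q → Edge F q w → Edge F w y →
        Unique (y ∷ w ∷ q ∷ p ∷ u ∷ x ∷ []) → (∀ t → t ∈ y ∷ w ∷ q ∷ p ∷ u ∷ x ∷ []) → ¬ ¬ Embeds F G
path₆ {F = F} {G} acyclic reg twin v (b , b′ , b≢b′ , fb , fb′) {x} xu up pq qw wy uq total ne
  with two-nbrs G (subst (2 ≤_) (sym (reg v)) (n≤1+n 2))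
... | a₁ , a₂ , a₁≢a₂ , va₁ , va₂
  with fresh (a₁ ∷ a₂ ∷ []) (nbrs-unique G v) (≤-reflexive (sym (trans (length-nbrs G v) (reg v))))
... | a₃ , a₃∈ , a₃∉ with uncons-unique uq
... | y∉ , uq₁ with uncons-unique uq₁
... | w∉ , uq₂ with uncons-unique uq₂
... | q∉ , uq₃ with uncons-unique uq₃
... | p∉ , uq₄ with uncons-unique uq₄
... | u∉ , _ = ne (partial-embeds {F = F} {G} acyclic
  (grow y∉ (edge-≢ G (twin-edge fb′ va₃) ∉∷ a₃∉ ∘ there ∘ here ∉∷ edge-≢ G (twin-edge fb va₃) ∉∷ a₃∉ ∘ here ∉∷ edge-≢ G (edge-sym G va₃) ∉∷ ∉-[]) (here refl) wy (edge-sym G (twin-edge fb′ va₃))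
  (grow w∉ (edge-≢ G (edge-sym G (twin-edge fb′ va₂)) ∉∷ (b≢b′ ∘ sym) ∉∷ edge-≢ G (edge-sym G (twin-edge fb′ va₁)) ∉∷ proj₁ fb′ ∉∷ ∉-[]) (here refl) qw (twin-edge fb′ va₂)
  (grow q∉ (edge-≢ G (twin-edge fb va₂) ∉∷ (a₁≢a₂ ∘ sym) ∉∷ edge-≢ G (edge-sym G va₂) ∉∷ ∉-[]) (here refl) pq (edge-sym G (twin-edge fb va₂))
  (grow p∉ (edge-≢ G (edge-sym G (twin-edge fb va₁)) ∉∷ proj₁ fb ∉∷ ∉-[]) (here refl) up (twin-edge fb va₁)
  (grow u∉ (edge-≢ G (edge-sym G va₁) ∉∷ ∉-[]) (here refl) xu va₁ (start x v)))))) total)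
  where
  va₃ : Edge G v a₃
  va₃ = ∈nbrs⁻ G a₃∈
  twin-edge : ∀ {b a} → Far G v b → Edge G v a → Edge G a b
  twin-edge (_ , v≁b) va = edge-sym G (twin (v≁b ∘ edge-sym G) va)

-- Embeddability is decidable, so the search for an embedding may argue by contradiction.
module _ {m : ℕ} where

  -- `resp` takes the place of function extensionality: a function agrees only pointwise with the
  -- one rebuilt from its head and tail.
  function? : ∀ k {P : (Fin k → Fin m) → Set} → (∀ {f g} → (∀ i → f i ≡ g i) → P f → P g) → (∀ f → Dec (P f)) → Dec (∃ P)
  function? zero resp P? = map′ (λ p → _ , p) (λ (f , p) → resp (λ ()) p) (P? λ ())
  function? (suc k) {P} resp P? = map′ (λ (a , f , p) → _ , p)
    (λ (f , p) → f zero , f ∘ suc , resp (λ { zero → refl ; (suc _) → refl }) p)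
    (any? λ a → function? k {λ f → P (a Vector.∷ f)}
      (λ e → resp λ { zero → refl ; (suc i) → e i }) (λ f → P? (a Vector.∷ f)))

embeds? : ∀ {n m} (F : Graph n) (G : Graph m) → Dec (Embeds F G)
embeds? {n} F G = function? n
  (λ e (inj , hom) → (λ {x} {y} q → inj (trans (e x) (trans q (sym (e y))))) ,
    λ x y xy → trans (cong₂ (adj G) (sym (e x)) (sym (e y))) (hom x y xy))
  λ f → map′ (λ h {x} {y} → h x y) (λ h x y → h) (all? λ x → all? λ y → (f x ≟ f y) →-dec (x ≟ y))
    ×-dec all? λ x → all? λ y → edge? F x y →-dec edge? G (f x) (f y)

-- The main argument

two≤deg : ∀ {n} (F : Graph n) {s a b} → Edge F s a → Edge F s b → a ≢ b → 2 ≤ deg F s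
two≤deg F {s} sa sb a≢b = subst (2 ≤_) (length-nbrs F s)
  (unique-⊆-length (cons-unique (a≢b ∉∷ ∉-[]) ([] ∷ [])) λ { (here refl) → ∈nbrs⁺ F sa ; (there (here refl)) → ∈nbrs⁺ F sb })

Exceptional : ∀ {n m} → Graph m → Graph n → Set
Exceptional {n} G F =
    (Σ ℕ λ p → Σ ℕ λ q → 1 ≤ p × 1 ≤ q × p + q + 3 ≡ n × G ≅ CompleteBipartite (p + q) × F ≅ T p q)
  ⊎ (Σ ℕ λ k → Σ ℕ λ a → 2 ≤ k × 1 ≤ a × k * a + 3 ≡ n × G ≅ CompleteMultipartite (1 + k) a × F ≅ T 1 (n ∸ 4))

record Legs {n m} (F : Graph n) (G : Graph m) (x u p y w q : Fin n) : Set where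
  field
    lx     : Leaf F x u
    ly     : Leaf F y w
    up     : Edge F u p
    wq     : Edge F w q
    nbrs-u : ∀ z → Edge F u z → z ≡ x ⊎ z ≡ p
    nbrs-w : ∀ z → Edge F w z → z ≡ y ⊎ z ≡ q
    x≢y    : x ≢ y
    u≢w    : u ≢ w
    p≢w    : p ≢ w
    q≢u    : q ≢ u
    Ku     : Kept F G x y u
    Kp     : Kept F G x y p
    Kw     : Kept F G x y w
    Kq     : Kept F G x y q

-- Completion counts free neighbours at `u` only, so what is shown about `p` carries over to `q` by
-- exchanging the legs.
flip-legs : ∀ {n m} {F : Graph n} {G : Graph m} {x u p y w q} → Legs F G x u p y w q → Legs F G y w q x u p
flip-legs L = record
  { lx = ly ; ly = lx ; up = wq ; wq = up ; nbrs-u = nbrs-w ; nbrs-w = nbrs-u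
  ; x≢y = x≢y ∘ sym ; u≢w = u≢w ∘ sym ; p≢w = q≢u ; q≢u = p≢w
  ; Ku = swap Kw ; Kp = swap Kq ; Kw = swap Ku ; Kq = swap Kp }
  where
  open Legs L

module _ {d m : ℕ} {F : Graph (3 + d)} {G : Graph m}
         (acyclic : ¬ HasCycle F) (conF : Connected F) (conG : Connected G)
         (large : 3 + d ≤ m) (δ : ∀ v → d ≤ deg G v) (Δ : ∀ x → deg F x ≤ d)
         (ne : ¬ Embeds F G) (generic : ¬ Exceptional G F) where

  some-vertex : Fin m
  some-vertex with fresh [] (Uniq.allFin⁺ m) (subst (0 <_) (sym (length-allFin m)) (≤-trans (s≤s z≤n) large))
  ... | v , _ = v

  module TwoLeaves {x u p x₂ : Fin (3 + d)} (lx : Leaf F x u) (up : Edge F u p)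
                   (leaves-u : ∀ t → Edge F u t → t ≢ p → Leaf F t u)
                   (ux₂ : Edge F u x₂) (x₂≢x : x₂ ≢ x) (x₂≢p : x₂ ≢ p) where

    lx₂ : Leaf F x₂ u
    lx₂ = leaves-u x₂ ux₂ x₂≢p

    module Ext = Extension acyclic conF conG large δ (x₂≢x ∘ sym) lx lx₂
      (completable-twins {F = F} {G} ne (x₂≢x ∘ sym) lx lx₂) (edge-≢ F (edge-sym F (proj₁ lx)) , edge-≢ F ux₂)

    kept : ∀ {t s} → Edge F t s → s ≢ u → Ext.K t
    kept ts s≢u = not-leaf {F = F} lx ts s≢u , not-leaf {F = F} lx₂ ts s≢u

    module _ {p₁} (pp₁ : Edge F p p₁) (p₁≢u : p₁ ≢ u) where

      p≢u : p ≢ u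
      p≢u = edge-≢ F (edge-sym F up)

      Kp : Ext.K p
      Kp = kept pp₁ p₁≢u

      Kp₁ : Ext.K p₁
      Kp₁ = kept (edge-sym F pp₁) p≢u

      only-p : ∀ t → Edge F p t → t ≡ u ⊎ t ≡ p₁
      only-p = Ext.only-two up pp₁ p₁≢u Kp Kp₁ λ pt _ → kept (edge-sym F pt) p≢u

      -- The tree would consist of `u`, its neighbours and `p₁`, so the degree of `u` would exceed
      -- `d`.
      four : Leaf F p₁ p → ⊥
      four lp₁ = <⇒≱ (s≤s (s≤s (s≤s (Δ u)))) (subst (λ k → 3 + d ≤ 2 + k) (length-nbrs F u)
        (closed-length F conF (u ∷ p₁ ∷ nbrs F u) (here refl) cl))
        where
        cl : ∀ {s t} → s ∈ u ∷ p₁ ∷ nbrs F u → Edge F s t → t ∈ u ∷ p₁ ∷ nbrs F u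
        cl (here refl) e = there (there (∈nbrs⁺ F e))
        cl (there (here refl)) e = there (there (subst (_∈ nbrs F u) (sym (proj₂ lp₁ _ e)) (∈nbrs⁺ F up)))
        cl {s} {t} (there (there s∈)) e with s ≟ p
        ... | no s≢p = here (proj₂ (leaves-u s (∈nbrs⁻ F s∈) s≢p) t e)
        ... | yes refl with only-p t e
        ... | inj₁ t≡u = here t≡u
        ... | inj₂ t≡p₁ = there (here t≡p₁)

      module _ {p₂} (p₁p₂ : Edge F p₁ p₂) (p₂≢p : p₂ ≢ p) (p₂≢u : p₂ ≢ u) where

        Kp₂ : Ext.K p₂
        Kp₂ = kept (edge-sym F p₁p₂) p₁≢u

        six : ∀ {p₃} → Edge F p₂ p₃ → p₃ ∉ p₂ ∷ p₁ ∷ p ∷ u ∷ [] → ⊥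
        six p₂p₃ p₃∉ = Ext.no-path up pp₁ p₁≢u Kp Kp₁ p₁p₂ p₂≢p p₂≢u Kp₂ some-vertex p₂p₃ p₃∉ (kept (edge-sym F p₂p₃) p₂≢u)

        -- Here F is T s t; two parts give the first exception. With more parts G has a triangle, so t = 1 and the second arises.
        five : (∀ t → Edge F p₁ t → t ≢ p → Leaf F t p₁) → ⊥
        five leaves-p₁ = shape (proj₁ form) (proj₂ form)
          where
          pu = edge-sym F up
          module Br = Broom F conF {p} {u} {p₁} (p₁≢u ∘ sym) pu pp₁ only-p leaves-u leaves-p₁
          -- The same tree with its hubs exchanged: the second exception lists the hub with a single
          -- leaf first.
          module Br′ = Broom F conF {p} {p₁} {u} p₁≢u pp₁ pu (λ t e → [ inj₂ , inj₁ ]′ (only-p t e)) leaves-p₁ leaves-u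
          twin : Ext.Twin up pp₁ p₁≢u Kp Kp₁ p₁p₂ p₂≢p p₂≢u Kp₂
          twin = Ext.twin up pp₁ p₁≢u Kp Kp₁ p₁p₂ p₂≢p p₂≢u Kp₂
          -- The common size of the parts: a part and the `d` neighbours of one of its vertices make
          -- up `G`.
          a = m ∸ d
          a+d≡m : a + d ≡ m
          a+d≡m = m∸n+n≡m (≤-trans (m≤n+m d 3) large)
          part-size : ∀ v → length (part G twin v) ≡ a
          part-size v = +-cancelʳ-≡ d _ _ (trans (cong (length (part G twin v) +_) (sym (Ext.regular up pp₁ p₁≢u Kp Kp₁ v)))
            (trans (length-part G twin v) (sym a+d≡m)))
          form : ∃ λ r → G ≅ CompleteMultipartite r a
          form = multipartite G twin part-size
          s = length (Br.others u)
          t = length (Br.others p₁)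
          s+t≡d : s + t ≡ d
          s+t≡d = +-cancelˡ-≡ 3 _ _ (trans (+-comm 3 (s + t)) Br.broom-size)
          nonempty : ∀ {z} {l : List (Fin (3 + d))} → z ∈ l → 1 ≤ length l
          nonempty (here _) = s≤s z≤n
          nonempty (there _) = s≤s z≤n
          1≤t : 1 ≤ t
          1≤t = nonempty (Br.∈others⁺ p₁p₂ p₂≢p)
          1≤a : 1 ≤ a
          1≤a = +-cancelʳ-≤ d 1 a (subst (1 + d ≤_) (sym a+d≡m) (≤-trans (m≤n+m (1 + d) 2) large))
          2≤d : 2 ≤ d
          2≤d = ≤-trans (two≤deg F pu pp₁ (p₁≢u ∘ sym)) (Δ p)
          shape : ∀ r → G ≅ CompleteMultipartite r a → ⊥
          -- No part means no vertex, and a single part means no edge, against `2 ≤ d`.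
          shape 0 iso = 1+n≰n (≤-trans (s≤s z≤n) (subst (3 + d ≤_) (≅-order G (CompleteMultipartite 0 a) iso) large))
          shape 1 iso = 1+n≰n (≤-trans (s≤s z≤n) (subst (2 ≤_) (+-cancelˡ-≡ a d 0 (trans a+d≡m (≅-order G (CompleteMultipartite 1 a) iso))) 2≤d))
          shape 2 iso = generic (inj₁ (s , t , nonempty (Br.∈others⁺ ux₂ x₂≢p) , 1≤t , Br.broom-size ,
            subst (λ b → G ≅ CompleteBipartite b) (trans (sym (+-identityʳ a))
              (trans (sym (+-cancelˡ-≡ a d (a + 0) (trans a+d≡m (≅-order G (CompleteMultipartite 2 a) iso)))) (sym s+t≡d))) iso ,
            Br.broom))
          shape (suc (suc (suc k))) iso = generic (inj₂ (2 + k , a , s≤s (s≤s z≤n) , 1≤a ,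
            trans (+-comm _ 3) (cong (3 +_) (sym d≡ka)) , iso , subst₂ (λ i j → F ≅ T i j) t≡1 s≡d∸1 Br′.broom))
            where
            d≡ka : d ≡ (2 + k) * a
            d≡ka = +-cancelˡ-≡ a _ _ (trans a+d≡m (≅-order G (CompleteMultipartite (3 + k) a) iso))
            -- One vertex from each of three parts gives the triangle for `no-broom`.
            j₀ : Fin a
            j₀ = fromℕ< 1≤a
            at : Fin (3 + k) → Fin m
            at i = proj₁ (≅⇒Embeds⁻¹ G (CompleteMultipartite (3 + k) a) iso) (combine i j₀)
            at-edge : ∀ {i i′} → i ≢ i′ → Edge G (at i) (at i′)
            at-edge i≢ = proj₂ (proj₂ (≅⇒Embeds⁻¹ G (CompleteMultipartite (3 + k) a) iso)) _ _ (multipartite-edge⁺ (3 + k) a j₀ j₀ i≢)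
            single : ∀ {z} → z ∈ Br.others p₁ → z ∈ p₂ ∷ []
            single {z} z∈ with z ≟ p₂ | Br.∈others⁻ z∈
            ... | yes z≡p₂ | _ = here z≡p₂
            ... | no z≢p₂ | p₁z , z≢p = ⊥-elim (Ext.no-broom up pp₁ p₁≢u Kp Kp₁ p₁p₂ p₂≢p p₂≢u Kp₂
              (at-edge {zero} {suc zero} λ ()) (at-edge {zero} {suc (suc zero)} λ ()) (at-edge {suc zero} {suc (suc zero)} λ ())
              p₁z (z≢p₂ ∉∷ edge-≢ F (edge-sym F p₁z) ∉∷ z≢p ∉∷ z≢u ∉∷ ∉-[]) (kept (edge-sym F p₁z) p₁≢u))
              where
              z≢u : z ≢ u
              z≢u refl = edge-≢ F pp₁ (proj₂ (leaves-p₁ u p₁z (edge-≢ F up)) p up)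
            t≡1 : t ≡ 1
            t≡1 = ≤-antisym (unique-⊆-length (Br.others-unique p₁) single) 1≤t
            -- With `n` equal to `3 + d`, the term `n ∸ 4` computes to `d ∸ 1`.
            s≡d∸1 : s ≡ d ∸ 1
            s≡d∸1 = trans (sym (m+n∸n≡m s 1)) (cong (_∸ 1) (trans (cong (s +_) (sym t≡1)) s+t≡d))

  module TwoLegs {x u p y w q : Fin (3 + d)} (legs : Legs F G x u p y w q) where
    open Legs legs

    2≤d : 2 ≤ d
    2≤d = ≤-trans (two≤deg F (edge-sym F (proj₁ lx)) up (proj₁ Kp ∘ sym)) (Δ u)

    private
      module Ext = Extension acyclic conF conG large δ x≢y lx ly
        (completable-legs 2≤d δ ne x≢y lx ly nbrs-u nbrs-w u≢w (edge-≢ F (edge-sym F wq)) q≢u (edge-≢ F (edge-sym F up)) Ku Kp Kw Kq) Ku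

    module _ {p₁} (pp₁ : Edge F p p₁) (p₁≢u : p₁ ≢ u) (Kp₁ : Kept F G x y p₁) where

      regular : ∀ v → deg G v ≡ d
      regular = Ext.regular up pp₁ p₁≢u Kp Kp₁

      only-p : ∀ t → Edge F p t → t ≡ u ⊎ t ≡ p₁
      only-p = Ext.only-two up pp₁ p₁≢u Kp Kp₁ λ pt _ →
        not-leaf {F = F} lx (edge-sym F pt) (edge-≢ F (edge-sym F up)) , not-leaf {F = F} ly (edge-sym F pt) p≢w

      module _ {p₂} (p₁p₂ : Edge F p₁ p₂) (p₂≢p : p₂ ≢ p) (p₂≢u : p₂ ≢ u) (Kp₂ : Kept F G x y p₂) where

        twin : ∀ {v z} → ¬ Edge G v z → ∀ {c} → Edge G z c → Edge G v c
        twin = Ext.twin up pp₁ p₁≢u Kp Kp₁ p₁p₂ p₂≢p p₂≢u Kp₂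

        two-far : ∀ v → ∃₂ λ b b′ → b ≢ b′ × Far G v b × Far G v b′
        two-far = Ext.two-far up pp₁ p₁≢u Kp Kp₁ p₁p₂ p₂≢p p₂≢u Kp₂

        no-path : ∀ {p₃} → Edge F p₂ p₃ → p₃ ∉ p₂ ∷ p₁ ∷ p ∷ u ∷ [] → Kept F G x y p₃ → ⊥
        no-path = Ext.no-path up pp₁ p₁≢u Kp Kp₁ p₁p₂ p₂≢p p₂≢u Kp₂ some-vertex

  -- A third neighbour of `u` supplies a second leaf to delete at `u`. A longest path on three or
  -- four vertices then makes the degree of `u` too large, five vertices lead to `T s t`, and from
  -- six on the path without `x` is long enough for `no-path`.
  two-leaves : ∀ {x u p z l} → Edge F x u → Edge F u p → (P : Path F p z l) → Unique (x ∷ u ∷ l) → Longest F (2 + length l) →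
               ∀ {x₂} → Edge F u x₂ → x₂ ≢ x → x₂ ≢ p → ⊥
  two-leaves {x} {u} {p} xu up P uq max {x₂} ux₂ x₂≢x x₂≢p = go P uq max
    (end-leaf F acyclic xu (cons up P) uq max) (end-leaves F acyclic xu up P uq max)
    where
    go : ∀ {z l} → Path F p z l → Unique (x ∷ u ∷ l) → Longest F (2 + length l) → Leaf F x u →
         (∀ t → Edge F u t → t ≢ p → Leaf F t u) → ⊥
    go nil uq max lx leaves-u = <⇒≱ (s≤s (s≤s (≤-trans (Δ u) (n≤1+n d)))) (subst (λ k → 3 + d ≤ 1 + k) (length-nbrs F u)
      (closed-length F conF (u ∷ nbrs F u) (here refl) cl))
      where
      lp : Leaf F p u
      lp = end-leaf F acyclic (edge-sym F up) (cons (edge-sym F xu) nil) (reverse-unique uq) max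
      cl : ∀ {s t} → s ∈ u ∷ nbrs F u → Edge F s t → t ∈ u ∷ nbrs F u
      cl (here refl) e = there (∈nbrs⁺ F e)
      cl {s} {t} (there s∈) e with s ≟ p
      ... | yes refl = here (proj₂ lp t e)
      ... | no s≢p = here (proj₂ (leaves-u s (∈nbrs⁻ F s∈) s≢p) t e)
    go (cons pp₁ nil) uq max lx leaves-u with uncons-unique (proj₂ (uncons-unique uq))
    ... | u∉ , _ = TwoLeaves.four lx up leaves-u ux₂ x₂≢x x₂≢p pp₁ (u∉ ∘ there ∘ here ∘ sym)
      (end-leaf F acyclic (edge-sym F pp₁) (cons (edge-sym F up) (cons (edge-sym F xu) nil)) (reverse-unique uq) max)
    go (cons pp₁ (cons p₁p₂ nil)) uq max lx leaves-u with uncons-unique (proj₂ (uncons-unique uq))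
    ... | u∉ , uq′ with uncons-unique uq′
    ... | p∉ , _ = TwoLeaves.five lx up leaves-u ux₂ x₂≢x x₂≢p pp₁ (u∉ ∘ there ∘ here ∘ sym) p₁p₂
      (p∉ ∘ there ∘ here ∘ sym) (u∉ ∘ there ∘ there ∘ here ∘ sym)
      (end-leaves F acyclic (edge-sym F p₁p₂) (edge-sym F pp₁) (cons (edge-sym F up) (cons (edge-sym F xu) nil)) (reverse-unique uq) max)
    go (cons pp₁ (cons p₁p₂ (cons {y = p₃} p₂p₃ P))) uq max lx leaves-u with path-head F P | uncons-unique (proj₂ (uncons-unique uq))
    ... | _ , refl | u∉ , uq′ with uncons-unique uq′
    ... | p∉ , uq″ with uncons-unique uq″
    ... | p₁∉ , uq‴ with uncons-unique uq‴
    ... | p₂∉ , _ = TwoLeaves.six lx up leaves-u ux₂ x₂≢x x₂≢p pp₁ (u∉ ∘ there ∘ here ∘ sym) p₁p₂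
      (p∉ ∘ there ∘ here ∘ sym) (u∉ ∘ there ∘ there ∘ here ∘ sym) p₂p₃
      (p₂∉ ∘ here ∘ sym ∉∷ p₁∉ ∘ there ∘ here ∘ sym ∉∷ p∉ ∘ there ∘ there ∘ here ∘ sym ∉∷ u∉ ∘ there ∘ there ∘ there ∘ here ∘ sym ∉∷ ∉-[])

  end-nbrs : ∀ {x u p z l} → Edge F x u → Edge F u p → (P : Path F p z l) → Unique (x ∷ u ∷ l) → Longest F (2 + length l) →
             ∀ t → Edge F u t → t ≡ x ⊎ t ≡ p
  end-nbrs {x} {p = p} xu up P uq max t ut with t ≟ x | t ≟ p
  ... | yes e | _ = inj₁ e
  ... | no _ | yes e = inj₂ e
  ... | no t≢x | no t≢p = ⊥-elim (two-leaves xu up P uq max ut t≢x t≢p)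

  -- Both inner vertices have degree two, so the tree is just this path; then `d` is at most 1, less
  -- than the degree of `u`.
  path-of-four : ∀ {x u p y} → Edge F x u → Edge F u p → Edge F p y → Unique (x ∷ u ∷ p ∷ y ∷ []) → Longest F 4 → ⊥
  path-of-four {x} {u} {p} {y} xu up py uq max = 1+n≰n (≤-trans (+-monoʳ-≤ 3
    (≤-trans (two≤deg F (edge-sym F xu) up x≢p) (Δ u)))
    (closed-length F conF (x ∷ u ∷ p ∷ y ∷ []) (here refl) cl))
    where
    x≢p = proj₁ (uncons-unique uq) ∘ there ∘ here
    P = cons py nil
    R = cons (edge-sym F xu) nil
    uq′ = reverse-unique uq
    cl : ∀ {s t} → s ∈ x ∷ u ∷ p ∷ y ∷ [] → Edge F s t → t ∈ x ∷ u ∷ p ∷ y ∷ []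
    cl (here refl) e = there (here (proj₂ (end-leaf F acyclic xu (cons up P) uq max) _ e))
    cl (there (here refl)) e with end-nbrs xu up P uq max _ e
    ... | inj₁ t≡x = here t≡x
    ... | inj₂ t≡p = there (there (here t≡p))
    cl (there (there (here refl))) e with end-nbrs (edge-sym F py) (edge-sym F up) R uq′ max _ e
    ... | inj₁ t≡y = there (there (there (here t≡y)))
    ... | inj₂ t≡u = there (here t≡u)
    cl (there (there (there (here refl)))) e =
      there (there (here (proj₂ (end-leaf F acyclic (edge-sym F py) (cons (edge-sym F up) R) uq′ max) _ e)))

  -- The legs meet in `p`, and only `u`, `p`, `w` survive the deletion: enough for regularity, not
  -- for twins. But the tree is then just this path, so `G` is 2-regular.
  path-of-five : ∀ {x u p w y} → Edge F x u → Edge F u p → Edge F p w → Edge F w y →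
                 Unique (x ∷ u ∷ p ∷ w ∷ y ∷ []) → Longest F 5 → ⊥
  path-of-five {x} {u} {p} {w} {y} xu up pw wy uq@((x≢u ∷ x≢p ∷ x≢w ∷ x≢y ∷ []) ∷ (u≢p ∷ u≢w ∷ u≢y ∷ []) ∷ (p≢w ∷ p≢y ∷ []) ∷ (w≢y ∷ []) ∷ _) max =
    path₅ {F = F} {G} acyclic conG (≤-trans (+-monoʳ-≤ 3 (TwoLegs.2≤d legs)) large)
      (λ v → trans (TwoLegs.regular legs pw (u≢w ∘ sym) Kw v) (≤-antisym d≤2 (TwoLegs.2≤d legs))) some-vertex
      xu up pw wy uq′ (closed-covers F conF W (here refl) cl) ne
    where
    P : Path F p y (p ∷ w ∷ y ∷ [])
    P = cons pw (cons wy nil)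
    R : Path F p x (p ∷ u ∷ x ∷ [])
    R = cons (edge-sym F up) (cons (edge-sym F xu) nil)
    uq′ : Unique (y ∷ w ∷ p ∷ u ∷ x ∷ [])
    uq′ = reverse-unique uq
    Kp : Kept F G x y p
    Kp = x≢p ∘ sym , p≢y
    Kw : Kept F G x y w
    Kw = x≢w ∘ sym , w≢y
    legs : Legs F G x u p y w p
    legs = record
      { lx = end-leaf F acyclic xu (cons up P) uq max ; ly = end-leaf F acyclic (edge-sym F wy) (cons (edge-sym F pw) R) uq′ max
      ; up = up ; wq = edge-sym F pw
      ; nbrs-u = end-nbrs xu up P uq max ; nbrs-w = end-nbrs (edge-sym F wy) (edge-sym F pw) R uq′ max
      ; x≢y = x≢y ; u≢w = u≢w ; p≢w = p≢w ; q≢u = u≢p ∘ sym ; Ku = x≢u ∘ sym , u≢y ; Kp = Kp ; Kw = Kw ; Kq = Kp }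
    W : List (Fin (3 + d))
    W = y ∷ w ∷ p ∷ u ∷ x ∷ []
    step-u : ∀ {t} → t ≡ x ⊎ t ≡ p → t ∈ W
    step-u (inj₁ t≡x) = there (there (there (there (here t≡x))))
    step-u (inj₂ t≡p) = there (there (here t≡p))
    step-p : ∀ {t} → t ≡ u ⊎ t ≡ w → t ∈ W
    step-p (inj₁ t≡u) = there (there (there (here t≡u)))
    step-p (inj₂ t≡w) = there (here t≡w)
    step-w : ∀ {t} → t ≡ y ⊎ t ≡ p → t ∈ W
    step-w (inj₁ t≡y) = here t≡y
    step-w (inj₂ t≡p) = there (there (here t≡p))
    steps : All (λ s → ∀ {t} → Edge F s t → t ∈ W) W
    steps = (λ e → there (here (proj₂ (Legs.ly legs) _ e)))
      ∷ (λ e → step-w (Legs.nbrs-w legs _ e))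
      ∷ (λ e → step-p (TwoLegs.only-p legs pw (u≢w ∘ sym) Kw _ e))
      ∷ (λ e → step-u (Legs.nbrs-u legs _ e))
      ∷ (λ e → there (there (there (here (proj₂ (Legs.lx legs) _ e))))) ∷ []
    cl : ∀ {s t} → s ∈ W → Edge F s t → t ∈ W
    cl s∈ = All.lookup steps s∈
    d≤2 : d ≤ 2
    d≤2 = +-cancelˡ-≤ 3 d 2 (closed-length F conF W (here refl) cl)

  -- The survivors `u`, `p`, `q`, `w` are enough for twins but one short of `no-path`. Again the
  -- tree is just the path, now with `d` equal to 3.
  path-of-six : ∀ {x u p q w y} → Edge F x u → Edge F u p → Edge F p q → Edge F q w → Edge F w y →
                Unique (x ∷ u ∷ p ∷ q ∷ w ∷ y ∷ []) → Longest F 6 → ⊥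
  path-of-six {x} {u} {p} {q} {w} {y} xu up pq qw wy
    uq@((x≢u ∷ x≢p ∷ x≢q ∷ x≢w ∷ x≢y ∷ []) ∷ (u≢p ∷ u≢q ∷ u≢w ∷ u≢y ∷ []) ∷ (p≢q ∷ p≢w ∷ p≢y ∷ []) ∷ (q≢w ∷ q≢y ∷ []) ∷ (w≢y ∷ []) ∷ _) max =
    path₆ {F = F} {G} acyclic
      (λ v → trans (TwoLegs.regular legs pq (u≢q ∘ sym) Kq v) (≤-antisym d≤3 (+-cancelˡ-≤ 3 3 d (unique-length≤ uq))))
      (TwoLegs.twin legs pq (u≢q ∘ sym) Kq qw (p≢w ∘ sym) (u≢w ∘ sym) Kw) some-vertex
      (TwoLegs.two-far legs pq (u≢q ∘ sym) Kq qw (p≢w ∘ sym) (u≢w ∘ sym) Kw some-vertex)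
      xu up pq qw wy uq′ (closed-covers F conF W (here refl) cl) ne
    where
    P : Path F p y (p ∷ q ∷ w ∷ y ∷ [])
    P = cons pq (cons qw (cons wy nil))
    R : Path F q x (q ∷ p ∷ u ∷ x ∷ [])
    R = cons (edge-sym F pq) (cons (edge-sym F up) (cons (edge-sym F xu) nil))
    uq′ : Unique (y ∷ w ∷ q ∷ p ∷ u ∷ x ∷ [])
    uq′ = reverse-unique uq
    Kp : Kept F G x y p
    Kp = x≢p ∘ sym , p≢y
    Kq : Kept F G x y q
    Kq = x≢q ∘ sym , q≢y
    Kw : Kept F G x y w
    Kw = x≢w ∘ sym , w≢y
    legs : Legs F G x u p y w q
    legs = record
      { lx = end-leaf F acyclic xu (cons up P) uq max ; ly = end-leaf F acyclic (edge-sym F wy) (cons (edge-sym F qw) R) uq′ max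
      ; up = up ; wq = edge-sym F qw
      ; nbrs-u = end-nbrs xu up P uq max ; nbrs-w = end-nbrs (edge-sym F wy) (edge-sym F qw) R uq′ max
      ; x≢y = x≢y ; u≢w = u≢w ; p≢w = p≢w ; q≢u = u≢q ∘ sym ; Ku = x≢u ∘ sym , u≢y ; Kp = Kp ; Kw = Kw ; Kq = Kq }
    W : List (Fin (3 + d))
    W = y ∷ w ∷ q ∷ p ∷ u ∷ x ∷ []
    step-u : ∀ {t} → t ≡ x ⊎ t ≡ p → t ∈ W
    step-u (inj₁ t≡x) = there (there (there (there (there (here t≡x)))))
    step-u (inj₂ t≡p) = there (there (there (here t≡p)))
    step-p : ∀ {t} → t ≡ u ⊎ t ≡ q → t ∈ W
    step-p (inj₁ t≡u) = there (there (there (there (here t≡u))))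
    step-p (inj₂ t≡q) = there (there (here t≡q))
    step-q : ∀ {t} → t ≡ w ⊎ t ≡ p → t ∈ W
    step-q (inj₁ t≡w) = there (here t≡w)
    step-q (inj₂ t≡p) = there (there (there (here t≡p)))
    step-w : ∀ {t} → t ≡ y ⊎ t ≡ q → t ∈ W
    step-w (inj₁ t≡y) = here t≡y
    step-w (inj₂ t≡q) = there (there (here t≡q))
    steps : All (λ s → ∀ {t} → Edge F s t → t ∈ W) W
    steps = (λ e → there (here (proj₂ (Legs.ly legs) _ e)))
      ∷ (λ e → step-w (Legs.nbrs-w legs _ e))
      ∷ (λ e → step-q (TwoLegs.only-p (flip-legs legs) (edge-sym F pq) p≢w (p≢y , x≢p ∘ sym) _ e))
      ∷ (λ e → step-p (TwoLegs.only-p legs pq (u≢q ∘ sym) Kq _ e))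
      ∷ (λ e → step-u (Legs.nbrs-u legs _ e))
      ∷ (λ e → there (there (there (there (here (proj₂ (Legs.lx legs) _ e)))))) ∷ []
    cl : ∀ {s t} → s ∈ W → Edge F s t → t ∈ W
    cl s∈ = All.lookup steps s∈
    d≤3 : d ≤ 3
    d≤3 = +-cancelˡ-≤ 3 d 3 (closed-length F conF W (here refl) cl)

  peel-end : ∀ {z p l} → Path F z p l → 3 ≤ length l →
             ∃ λ w → ∃ λ q → ∃ λ r → Edge F z w × Edge F w q × Path F q p r × l ≡ z ∷ w ∷ r
  peel-end nil (s≤s ())
  peel-end (cons _ nil) (s≤s (s≤s ()))
  peel-end (cons zw (cons wq R)) _ = _ , _ , _ , zw , wq , R , refl

  -- Seven vertices are enough: without the two ends at least five remain, as `no-path` requires.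
  -- The leg at the far end is read off the reversed path.
  long-path : ∀ {x u p p₁ p₂ p₃ p₄ y l} → Edge F x u → Edge F u p → Edge F p p₁ → Edge F p₁ p₂ → Edge F p₂ p₃ → Edge F p₃ p₄ →
              Path F p₄ y (p₄ ∷ l) → Unique (x ∷ u ∷ p ∷ p₁ ∷ p₂ ∷ p₃ ∷ p₄ ∷ l) → Longest F (7 + length l) → ⊥
  long-path {x} {u} {p} {p₁} {p₂} {p₃} {p₄} {y} {l} xu up pp₁ p₁p₂ p₂p₃ p₃p₄ Q
    uq@(x∉@(x≢u ∷ x≢p ∷ x≢p₁ ∷ x≢p₂ ∷ x≢p₃ ∷ _) ∷ uq₁@(u∉@(u≢p ∷ u≢p₁ ∷ u≢p₂ ∷ u≢p₃ ∷ _) ∷ uq₂@((_ ∷ p≢p₂ ∷ p≢p₃ ∷ _) ∷ (_ ∷ p₁≢p₃ ∷ _) ∷ (_ ∷ p₂≢p₄ ∷ _) ∷ _))) max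
    = ends (peel-end (reverse-path F P) (subst (3 ≤_) (sym (length-reverse t)) (s≤s (s≤s (s≤s z≤n)))))
    where
    t : List (Fin (3 + d))
    t = p ∷ p₁ ∷ p₂ ∷ p₃ ∷ p₄ ∷ l
    P : Path F p y t
    P = cons pp₁ (cons p₁p₂ (cons p₂p₃ (cons p₃p₄ Q)))
    x≢ : ∀ {z} → z ∈ t → x ≢ z
    x≢ z∈ = All.lookup x∉ (there z∈)
    u≢ : ∀ {z} → z ∈ t → u ≢ z
    u≢ z∈ = All.lookup u∉ z∈
    ends : (∃ λ w → ∃ λ q → ∃ λ r → Edge F y w × Edge F w q × Path F q p r × reverse t ≡ y ∷ w ∷ r) → ⊥
    ends (w , q , r , yw , wq , R , rev≡) = TwoLegs.no-path legs pp₁ (u≢p₁ ∘ sym) Kp₁ p₁p₂ (p≢p₂ ∘ sym) (u≢p₂ ∘ sym) Kp₂ p₂p₃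
      (edge-≢ F (edge-sym F p₂p₃) ∉∷ (p₁≢p₃ ∘ sym) ∉∷ (p≢p₃ ∘ sym) ∉∷ (u≢p₃ ∘ sym) ∉∷ ∉-[]) Kp₃
      where
      back : ∀ {z} → z ∈ y ∷ w ∷ r → z ∈ t
      back {z} z∈ = reverse⁻ (subst (z ∈_) (sym rev≡) z∈)
      q∈r : q ∈ r
      q∈r = subst (q ∈_) (sym (proj₂ (path-head F R))) (here refl)
      y∈ : y ∈ t
      y∈ = back (here refl)
      w∈ : w ∈ t
      w∈ = back (there (here refl))
      q∈ : q ∈ t
      q∈ = back (there (there q∈r))
      uq-end : Unique (y ∷ w ∷ r)
      uq-end = subst Unique rev≡ (reverse-unique uq₂)
      -- The reversed tail continued by `u` and `x`: the same longest path seen from `y`, without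
      -- its first two vertices.
      r′ : List (Fin (3 + d))
      r′ = (r ++ u ∷ []) ++ x ∷ []
      R′ : Path F q x r′
      R′ = snoc F (snoc F R (edge-sym F up)) (edge-sym F xu)
      uq′ : Unique (y ∷ w ∷ r′)
      uq′ = snoc-unique {l = y ∷ w ∷ (r ++ u ∷ [])} (snoc-unique {l = y ∷ w ∷ r} uq-end λ u∈ → u≢ (back u∈) refl)
        λ x∈ → [ (λ x∈ → x≢ (back x∈) refl) , (λ { (here x≡u) → x≢u x≡u }) ]′ (∈-++⁻ (y ∷ w ∷ r) x∈)
      same : 7 + length l ≡ 2 + length r′
      same = cong (2 +_) (trans (sym (length-reverse t)) (trans (cong length rev≡)
        (sym (trans (length-++ (r ++ u ∷ [])) (trans (cong (_+ 1) (length-++ r))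
          (trans (+-assoc (length r) 1 1) (+-comm (length r) 2)))))))
      max′ : Longest F (2 + length r′)
      max′ = subst (Longest F) same max
      lx : Leaf F x u
      lx = end-leaf F acyclic xu (cons up P) uq max
      ly : Leaf F y w
      ly = end-leaf F acyclic yw (cons wq R′) uq′ max′
      nbrs-u : ∀ z → Edge F u z → z ≡ x ⊎ z ≡ p
      nbrs-u = end-nbrs xu up P uq max
      nbrs-w : ∀ z → Edge F w z → z ≡ y ⊎ z ≡ q
      nbrs-w = end-nbrs yw wq R′ uq′ max′
      from-two : ∀ {s a b} → Edge F s a → Edge F s b → a ≢ b → s ≢ y
      from-two {a = a} {b} sa sb a≢b refl = a≢b (trans (proj₂ ly a sa) (sym (proj₂ ly b sb)))
      Kp : Kept F G x y p
      Kp = x≢p ∘ sym , from-two (edge-sym F up) pp₁ u≢p₁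
      Kp₁ : Kept F G x y p₁
      Kp₁ = x≢p₁ ∘ sym , from-two (edge-sym F pp₁) p₁p₂ p≢p₂
      Kp₂ : Kept F G x y p₂
      Kp₂ = x≢p₂ ∘ sym , from-two (edge-sym F p₁p₂) p₂p₃ p₁≢p₃
      Kp₃ : Kept F G x y p₃
      Kp₃ = x≢p₃ ∘ sym , from-two (edge-sym F p₂p₃) p₃p₄ p₂≢p₄
      p≢w : p ≢ w
      p≢w p≡w = [ u≢ y∈ , u≢ q∈ ]′ (nbrs-w u (subst (λ v → Edge F v u) p≡w (edge-sym F up)))
      legs : Legs F G x u p y w q
      legs = record
        { lx = lx ; ly = ly ; up = up ; wq = wq ; nbrs-u = nbrs-u ; nbrs-w = nbrs-w
        ; x≢y = x≢ y∈ ; u≢w = u≢ w∈ ; p≢w = p≢w ; q≢u = u≢ q∈ ∘ sym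
        ; Ku = x≢u ∘ sym , u≢ y∈ ; Kp = Kp ; Kw = x≢ w∈ ∘ sym , edge-≢ F (edge-sym F yw)
        ; Kq = x≢ q∈ ∘ sym , λ q≡y → proj₁ (uncons-unique uq-end) (there (subst (_∈ r) q≡y q∈r)) }

  impossible : ⊥
  impossible = longest-path F zero go
    where
    no-short : ∀ {x u} → Edge F x u → Longest F 2 → ∀ {t} → Edge F x t → t ∈ x ∷ u ∷ []
    no-short {x} {u} xu max {t} xt with t ∈? (x ∷ u ∷ [])
    ... | yes t∈ = t∈
    ... | no t∉ = ⊥-elim (1+n≰n (max (cons (edge-sym F xt) (cons xu nil)) (cons-unique t∉ (cons-unique (edge-≢ F xu ∉∷ ∉-[]) ([] ∷ [])))))
    exchange : ∀ {t x u : Fin (3 + d)} → t ∈ u ∷ x ∷ [] → t ∈ x ∷ u ∷ []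
    exchange (here e) = there (here e)
    exchange (there (here e)) = here e
    go : ∀ {x z l} → Path F x z l → Unique l → Longest F (length l) → ⊥
    go {x} nil uq max = 1+n≰n (≤-trans (s≤s (s≤s z≤n)) (closed-length F conF (x ∷ []) (here refl) cl))
      where
      cl : ∀ {s t} → s ∈ x ∷ [] → Edge F s t → t ∈ x ∷ []
      cl (here refl) e = ⊥-elim (1+n≰n (max (cons e nil) (cons-unique (edge-≢ F e ∉∷ ∉-[]) ([] ∷ []))))
    go {x} (cons {y = u} xu nil) uq max = 1+n≰n (≤-trans (s≤s (s≤s (s≤s z≤n))) (closed-length F conF (x ∷ u ∷ []) (here refl) cl))
      where
      cl : ∀ {s t} → s ∈ x ∷ u ∷ [] → Edge F s t → t ∈ x ∷ u ∷ []
      cl (here refl) e = no-short xu max e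
      cl (there (here refl)) e = exchange (no-short (edge-sym F xu) max e)
    go (cons {x = x} xu (cons {x = u} {y = p} up nil)) uq max = 1+n≰n (≤-trans (+-monoʳ-≤ 2
      (≤-trans (two≤deg F (edge-sym F xu) up (proj₁ (uncons-unique uq) ∘ there ∘ here)) (Δ u)))
      (≤-trans (n≤1+n _) (closed-length F conF (x ∷ u ∷ p ∷ []) (here refl) cl)))
      where
      cl : ∀ {s t} → s ∈ x ∷ u ∷ p ∷ [] → Edge F s t → t ∈ x ∷ u ∷ p ∷ []
      cl (here refl) e = there (here (proj₂ (end-leaf F acyclic xu (cons up nil) uq max) _ e))
      cl (there (here refl)) e with end-nbrs xu up nil uq max _ e
      ... | inj₁ t≡x = here t≡x
      ... | inj₂ t≡p = there (there (here t≡p))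
      cl (there (there (here refl))) e =
        there (here (proj₂ (end-leaf F acyclic (edge-sym F up) (cons (edge-sym F xu) nil) (reverse-unique uq) max) _ e))
    go (cons xu (cons up (cons pp₁ nil))) = path-of-four xu up pp₁
    go (cons xu (cons up (cons pp₁ (cons p₁p₂ nil)))) = path-of-five xu up pp₁ p₁p₂
    go (cons xu (cons up (cons pp₁ (cons p₁p₂ (cons p₂p₃ nil))))) = path-of-six xu up pp₁ p₁p₂ p₂p₃
    go (cons xu (cons up (cons pp₁ (cons p₁p₂ (cons p₂p₃ (cons p₃p₄ P)))))) uq max with path-head F P
    ... | _ , refl = long-path xu up pp₁ p₁p₂ p₂p₃ p₃p₄ P uq max

-- The equivalence

¬exceptional-embeds : ∀ {n m} (F : Graph n) (G : Graph m) → Embeds F G → ¬ Exceptional G F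
¬exceptional-embeds F G emb (inj₁ (p , q , _ , _ , _ , G≅ , F≅)) = ¬T⊆bipartite p q
  (Embeds-trans (T p q) F (CompleteBipartite (p + q)) (≅⇒Embeds⁻¹ F (T p q) F≅) (Embeds-trans F G (CompleteBipartite (p + q)) emb (≅⇒Embeds G (CompleteBipartite (p + q)) G≅)))
¬exceptional-embeds F G emb (inj₂ (k , a , _ , _ , refl , G≅ , F≅)) = ¬T⊆multipartite k a (k * a + 3 ∸ 4) bound
  (Embeds-trans (T 1 (k * a + 3 ∸ 4)) F (CompleteMultipartite (1 + k) a) (≅⇒Embeds⁻¹ F (T 1 (k * a + 3 ∸ 4)) F≅)
    (Embeds-trans F G (CompleteMultipartite (1 + k) a) emb (≅⇒Embeds G (CompleteMultipartite (1 + k) a) G≅)))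
  where
  -- The subtraction amounts to `k * a ∸ 1`; the bound survives its truncation at zero.
  bound : k * a ≤ suc (k * a + 3 ∸ 4)
  bound rewrite +-comm (k * a) 3 = suc-pred≥ (k * a)
    where
    suc-pred≥ : ∀ b → b ≤ suc (b ∸ 1)
    suc-pred≥ zero = z≤n
    suc-pred≥ (suc b) = ≤-refl

theorem1p3 : (n m : ℕ) → 1 ≤ n → (G : Graph m) → Connected G → n ≤ m
    → ((x : Fin m) → n ≤ deg G x + 3)
    → (Tn : Graph n) → IsTree Tn → ((x : Fin n) → deg Tn x + 3 ≤ n)
    → Embeds Tn G ⇔
    (¬ ((Σ ℕ λ p → Σ ℕ λ q → 1 ≤ p × 1 ≤ q × p + q + 3 ≡ n
    × G ≅ CompleteBipartite (p + q) × Tn ≅ T p q)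
    ⊎ (Σ ℕ λ k → Σ ℕ λ a → 2 ≤ k × 1 ≤ a × k * a + 3 ≡ n
    × G ≅ CompleteMultipartite (1 + k) a × Tn ≅ T 1 (n ∸ 4))))
theorem1p3 (suc (suc (suc d))) m _ G conG n≤m δ F (conF , acyclic) Δ = mk⇔ (¬exceptional-embeds F G) λ generic →
  decidable-stable (embeds? F G) λ ne → impossible acyclic conF conG n≤m
    (λ v → +-cancelˡ-≤ 3 _ _ (subst (3 + d ≤_) (+-comm (deg G v) 3) (δ v)))
    (λ x → +-cancelˡ-≤ 3 _ _ (subst (_≤ 3 + d) (+-comm (deg F x) 3) (Δ x))) ne generic
-- Trees on one or two vertices violate the degree bound at every vertex.
theorem1p3 1 m _ G conG n≤m δ F tree Δ = ⊥-elim (<⇒≱ (s≤s (s≤s z≤n)) (≤-trans (m≤n+m 3 (deg F zero)) (Δ zero)))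
theorem1p3 2 m _ G conG n≤m δ F tree Δ = ⊥-elim (<⇒≱ (s≤s (s≤s (s≤s z≤n))) (≤-trans (m≤n+m 3 (deg F zero)) (Δ zero)))
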